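{- There does not exist an isolation scheme for Hamiltonian cycles on graphs of treewidth at most $4$ that uses $o(\log n)$ random bits and polynomially bounded weights (where $n$ is the number of vertices).
   Context: For $\omega\colon U\to\mathbb{N}$, $\omega(X)=\sum_{e\in X}\omega(e)$, and $\omega$ isolates $\mathcal{F}\subseteq 2^U$ if exactly one member of $\mathcal{F}$ attains the minimum weight. $\mathsf{HC}(G)$ denotes the family of edge sets of Hamiltonian cycles of $G$. An isolation scheme for Hamiltonian cycles on a graph class $\mathcal{C}$ is, for every $m$, a list of weight functions $\omega_1,\ldots,\omega_\ell\colon[m]\to\mathbb{N}$ such that for every $G\in\mathcal{C}$ with edges enumerated by $[m]$, at least half of the $\omega_i$ isolate $\mathsf{HC}(G)$; it uses $\log\ell$ random bits and its maximum weight is the largest value of the $\omega_i$. -}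

module Defs where

open import Data.Nat using (ℕ; zero; suc; _+_; _*_; _^_; _≤_; _<_)
open import Data.Nat.DivMod using (_mod_)
open import Data.Fin using (Fin; toℕ) renaming (zero to fzero; suc to fsuc)
open import Data.Fin.Subset using (Subset; _∈_; ∣_∣)
open import Data.Vec using (lookup)
open import Data.List using (map; allFin)
open import Data.Nat.ListAction using (sum)
open import Data.Bool using (if_then_else_)
open import Data.Product using (Σ; ∃; ∃-syntax; _×_; _,_; proj₁; proj₂)
open import Data.Sum using (_⊎_)
open import Relation.Binary.PropositionalEquality using (_≡_; _≢_)
open import Function.Definitions using (Injective)
open import Function.Bundles using (_⇔_)

SameEnds : ∀ {n} → Fin n × Fin n → Fin n × Fin n → Set
SameEnds (a , b) (c , d) = (a ≡ c × b ≡ d) ⊎ (a ≡ d × b ≡ c)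

record Graph (n m : ℕ) : Set where
  field
    ends     : Fin m → Fin n × Fin n
    loopless : ∀ e → proj₁ (ends e) ≢ proj₂ (ends e)
    simple   : ∀ e f → SameEnds (ends e) (ends f) → e ≡ f
open Graph public

Joins : ∀ {n m} → Graph n m → Fin m → Fin n → Fin n → Set
Joins G e u v = SameEnds (ends G e) (u , v)

succMod : ∀ {n} → Fin n → Fin n
succMod {suc k} i = suc (toℕ i) mod suc k

IsHC : ∀ {n m} → Graph n m → Subset m → Set
IsHC {n} {m} G S =
  3 ≤ n ×
  Σ (Fin n → Fin n) λ σ →
    Injective _≡_ _≡_ σ ×
    (∀ i → ∃[ e ] Joins G e (σ i) (σ (succMod i))) ×
    (∀ e → (e ∈ S) ⇔ (∃[ i ] Joins G e (σ i) (σ (succMod i))))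

weight : ∀ {m} → (Fin m → ℕ) → Subset m → ℕ
weight {m} ω X = sum (map (λ e → if lookup X e then ω e else 0) (allFin m))

Isolates : ∀ {m} → (Fin m → ℕ) → (Subset m → Set) → Set
Isolates ω F =
  Σ _ λ S → F S × (∀ T → F T → T ≢ S → weight ω S < weight ω T)

-- Tree decompositions. The tree has nodes Fin (suc size), root fzero,
-- and node fsuc j has parent (parent j) with smaller index.

TreeAdj : ∀ {k} → (Fin k → Fin (suc k)) → Fin (suc k) → Fin (suc k) → Set
TreeAdj {k} parent t t' =
  ∃[ j ] ((t ≡ fsuc j × t' ≡ parent j) ⊎ (t' ≡ fsuc j × t ≡ parent j))

data Walk {k} (parent : Fin k → Fin (suc k)) (P : Fin (suc k) → Set)
          : Fin (suc k) → Fin (suc k) → Set where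
  stay : ∀ {t} → P t → Walk parent P t t
  step : ∀ {t t' u} → P t → TreeAdj parent t t' → Walk parent P t' u →
         Walk parent P t u

record TreeDecomposition {n m} (G : Graph n m) (width : ℕ) : Set where
  field
    size       : ℕ
    parent     : Fin size → Fin (suc size)
    parent-<   : ∀ j → toℕ (parent j) ≤ toℕ j
    bag        : Fin (suc size) → Subset n
    bag-size   : ∀ t → ∣ bag t ∣ ≤ suc width
    cover-vert : ∀ v → ∃[ t ] v ∈ bag t
    cover-edge : ∀ e → ∃[ t ] (proj₁ (ends G e) ∈ bag t × proj₂ (ends G e) ∈ bag t)
    connected  : ∀ v t t' → v ∈ bag t → v ∈ bag t' →
                 Walk parent (λ s → v ∈ bag s) t t'

TreewidthAtMost : ∀ {n m} → Graph n m → ℕ → Set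
TreewidthAtMost G w = TreeDecomposition G w

record IsolationScheme (tw : ℕ) : Set where
  field
    len     : ℕ → ℕ                       -- ℓ(m); uses log ℓ(m) random bits
    len-pos : ∀ m → 1 ≤ len m
    weights : (m : ℕ) → Fin (len m) → Fin m → ℕ
    good    : ∀ {n m} (G : Graph n m) → TreewidthAtMost G tw →
              (∃[ S ] IsHC G S) →
              Σ (Subset (len m)) λ I →
                len m ≤ 2 * ∣ I ∣ ×
                (∀ i → i ∈ I → Isolates (weights m i) (IsHC G))
open IsolationScheme public

-- log ℓ(m) = o(log m):  for every c, eventually ℓ(m)^c ≤ m
SubLogBits : ∀ {tw} → IsolationScheme tw → Set
SubLogBits s = ∀ c → ∃[ N ] (∀ m → N ≤ m → len s m ^ c ≤ m)

PolyWeights : ∀ {tw} → IsolationScheme tw → Set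
PolyWeights s =
  ∃[ c ] ∃[ N ] (∀ m → N ≤ m → ∀ i e → weights s m i e ≤ m ^ c)

{-# OPTIONS --safe #-}
-- A single graph defeats all weight functions at once. It consists of a cycle c₀, …, cₙ₋₁ on
-- 0, …, n-1 and chords b₀, …, b_K, arranged as a ladder with one return path, so that it has exactly
-- two Hamiltonian cycles: the cycle itself, and the one obtained from it by replacing every c_{2j}
-- (j ≤ K) by b_j. If the labels on the c_{2j} and those on the b_j have equal total weight under each
-- weight function, then none of them isolates. Such labels exist by pigeonhole: ℓ weight functions
-- bounded by m^c take at most m^O(cℓ) values on the 2^k ways to choose one label from each of k
-- disjoint pairs, so two choices agree once k ≫ cℓ log m. Since ℓ ≤ √m, such a k still fits into m;
-- the labels are read off where the two choices differ. All other labels go to the remaining edges of the cycle.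
module Submission where

open import Defs
open import Data.Bool using (Bool; true; false; if_then_else_)
open import Data.Fin using (Fin; toℕ; fromℕ; fromℕ<; inject₁; inject≤; pred; punchOut; splitAt; join; combine; funToFin; finToFun; _↑ˡ_; _↑ʳ_) renaming (zero to fzero; suc to fsuc)
open import Data.Fin.Induction using (<-weakInduction)
open import Data.Fin.Permutation using (Permutation′; _⟨$⟩ʳ_; _⟨$⟩ˡ_; inverseʳ; inverseˡ; _∘ₚ_; transpose; flip) renaming (id to idₚ)
import Data.Fin.Permutation.Components as Components
import Data.Fin.Properties as Fin
open import Data.Fin.Relation.Unary.Top using (view; ‵fromℕ; ‵inject₁)
open import Data.Fin.Subset using (Subset; _∈_; _∉_; ∣_∣; _∪_; ⁅_⁆; ⋃; Nonempty)
open import Data.Fin.Subset.Properties using (x∈⁅x⁆; x∈p∪q⁺; ∣⁅x⁆∣≡1; p⊆q⇒∣p∣≤∣q∣; ∣⊥∣≡0; _∈?_; nonempty?; Empty-unique)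
open import Data.List using (List; []; _∷_; map; length) renaming (tabulate to tabulateᴸ)
import Data.List.Membership.Propositional as List
open import Data.List.Properties using (map-tabulate)
open import Data.List.Relation.Unary.Any using (here; there)
open import Data.Nat using (ℕ; zero; suc; _+_; _*_; _^_; _⊓_; _≤_; _<_; z≤n; s≤s; _≤?_; _<?_; _≟_)
open import Data.Nat.DivMod using (_%_; m<n⇒m%n≡m; n%n≡0; m%n<n)
import Data.Nat.ListAction as List
import Data.Nat.Properties as ℕ
open import Data.Nat.Tactic.RingSolver using (solve-∀)
open import Data.Product using (Σ; ∃-syntax; ∃₂; _×_; _,_; proj₁; proj₂)
open import Data.Sum using (_⊎_; inj₁; inj₂; [_,_]′)
open import Data.Vec using (lookup; tabulate; []; _∷_)
open import Data.Vec.Properties using (lookup∘tabulate; tabulate∘lookup; tabulate-cong; lookup⇒[]=; []=⇒lookup)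
open import Function using (_∘_; id)
open import Function.Bundles using (Equivalence; Injection)
open import Function.Definitions using (Injective)
open import Function.Properties.Inverse using (↔⇒↣)
open import Relation.Binary.PropositionalEquality
open import Relation.Nullary using (¬_; Dec; yes; no; does; contradiction)
open import Relation.Nullary.Decidable using (dec-true; dec-false; ¬?; _×-dec_; _⊎-dec_)
open import Algebra.Properties.CommutativeMonoid.Sum ℕ.+-0-commutativeMonoid using (sum; sum-cong-≗; sum-permute; ∑-comm; ∑-distrib-+; sum-replicate-zero)

-- Sums

-- The weight functions of a scheme depend on `m` alone, so they are fixed before the graph is, and
-- the graph may be adapted to them by permuting its edge labels. With only two competing
-- Hamiltonian cycles, failure of isolation is a single equation per weight function, between two
-- disjoint sets of equally many edges. Choosing from disjoint pairs yields just that: where two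
-- choices differ, they take opposite members of the same pairs. The pigeonhole principle bounds the
-- number `K + 1` of differences by `k` but does not determine it; the return path absorbs the
-- surplus edges, whatever that number is. It has to be at least two, because for `K = 0` the only
-- chord would be parallel to the edge from 0 to 1. Treewidth 4 comes from bags made of vertex 0,
-- where the return path closes, and four consecutive vertices, since chords span at most three. All
-- bounds are in terms of `m`; in the ladder `n ≤ m ≤ 2n`, so `log m` and `log n` have the same
-- order.

sum-tabulate : ∀ {n} (f : Fin n → ℕ) → List.sum (tabulateᴸ f) ≡ sum f
sum-tabulate {zero}  f = refl
sum-tabulate {suc n} f = cong (f fzero +_) (sum-tabulate (f ∘ fsuc))

restrict : ∀ {m} → Subset m → (Fin m → ℕ) → Fin m → ℕ
restrict S ω e = if lookup S e then ω e else 0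

weight≡sum : ∀ {m} (ω : Fin m → ℕ) S → weight ω S ≡ sum (restrict S ω)
weight≡sum ω S = trans (cong List.sum (map-tabulate id (restrict S ω))) (sum-tabulate (restrict S ω))

sum-↑ : ∀ m {n} (f : Fin (m + n) → ℕ) →
        sum f ≡ sum (f ∘ (_↑ˡ n)) + sum (f ∘ (m ↑ʳ_))
sum-↑ zero    f = refl
sum-↑ (suc m) f = trans (cong (f fzero +_) (sum-↑ m (f ∘ fsuc)))
                        (sym (ℕ.+-assoc (f fzero) _ _))

sum-zero : ∀ {n} {f : Fin n → ℕ} → (∀ i → f i ≡ 0) → sum f ≡ 0
sum-zero {n} f≗0 = trans (sum-cong-≗ f≗0) (sum-replicate-zero n)

sum-≤ : ∀ {n W} (f : Fin n → ℕ) → (∀ i → f i ≤ W) → sum f ≤ n * W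
sum-≤ {zero}  f f≤W = z≤n
sum-≤ {suc n} f f≤W = ℕ.+-mono-≤ (f≤W fzero) (sum-≤ (f ∘ fsuc) (f≤W ∘ fsuc))

sum-indicator : ∀ {n} (g : Fin n → ℕ) a →
                sum (λ i → if does (a Fin.≟ i) then g i else 0) ≡ g a
sum-indicator {suc n} g fzero    = trans (cong (g fzero +_) (sum-zero {n} λ _ → refl)) (ℕ.+-identityʳ _)
sum-indicator {suc n} g (fsuc a) = sum-indicator (g ∘ fsuc) a

-- Write `h i` as the sum over `j` of `g i` wherever `e j ≡ i`. Injectivity lets at most one `j`
-- contribute, and exchanging the two summations leaves one term for each `j`.
sum-image : ∀ {d n} (e : Fin d → Fin n) → Injective _≡_ _≡_ e →
            ∀ (g h : Fin n → ℕ) →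
            (∀ j → h (e j) ≡ g (e j)) → (∀ i → (∀ j → e j ≢ i) → h i ≡ 0) →
            sum h ≡ sum (g ∘ e)
sum-image {d} {n} e e-inj g h h-on h-off = begin
  sum h                                   ≡⟨ sum-cong-≗ column ⟩
  sum (λ i → sum (λ j → cell j i))        ≡⟨ ∑-comm {n} {d} (λ i j → cell j i) ⟩
  sum (λ j → sum (cell j))                ≡⟨ sum-cong-≗ (λ j → sum-indicator g (e j)) ⟩
  sum (g ∘ e)                             ∎
  where
  open ≡-Reasoning
  cell : Fin d → Fin n → ℕ
  cell j i = if does (e j Fin.≟ i) then g i else 0
  same : ∀ j j' → cell j' (e j) ≡ (if does (j Fin.≟ j') then g (e j) else 0)
  same j j' with j Fin.≟ j'
  ... | yes refl rewrite dec-true (e j Fin.≟ e j) refl = refl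
  ... | no j≢j' rewrite dec-false (e j' Fin.≟ e j) (j≢j' ∘ sym ∘ e-inj) = refl
  column : ∀ i → h i ≡ sum (λ j → cell j i)
  column i with Fin.any? (λ j → e j Fin.≟ i)
  ... | yes (j , refl) = trans (h-on j)
          (sym (trans (sum-cong-≗ (same j)) (sum-indicator (λ _ → g (e j)) j)))
  ... | no ∄j = trans (h-off i (λ j eq → ∄j (j , eq)))
          (sym (sum-zero λ j → cong (if_then g i else 0) (dec-false (e j Fin.≟ i) λ eq → ∄j (j , eq))))

-- Hamiltonian cycles

-- A missed value `y` could be punched out of the codomain, giving an injection of `Fin (suc n)`
-- into `Fin n`.
injective⇒surjective : ∀ {n} {f : Fin n → Fin n} → Injective _≡_ _≡_ f → ∀ y → ∃[ x ] f x ≡ y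
injective⇒surjective {suc n} {f} f-inj y with Fin.any? (λ x → f x Fin.≟ y)
... | yes found = found
... | no  ∄x    = contradiction
  (λ {i} {j} eq → f-inj (Fin.punchOut-injective (y≢ i) (y≢ j) eq))
  (Fin.<⇒notInjective {f = λ x → punchOut (y≢ x)} (ℕ.n<1+n n))
  where
  y≢ : ∀ x → y ≢ f x
  y≢ x eq = ∄x (x , sym eq)

succMod-step : ∀ {n} (i : Fin n) → suc (toℕ i) < n → toℕ (succMod i) ≡ suc (toℕ i)
succMod-step {suc k} i i+1<n = trans (Fin.toℕ-fromℕ< (m%n<n (suc (toℕ i)) (suc k))) (m<n⇒m%n≡m i+1<n)

succMod-wrap : ∀ {n} (i : Fin n) → suc (toℕ i) ≡ n → toℕ (succMod i) ≡ 0
succMod-wrap {suc k} i i+1≡n = begin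
  toℕ (succMod i)                    ≡⟨ Fin.toℕ-fromℕ< (m%n<n (suc (toℕ i)) (suc k)) ⟩
  suc (toℕ i) % suc k ≡⟨ cong (_% suc k) i+1≡n ⟩
  suc k % suc k      ≡⟨ n%n≡0 (suc k) ⟩
  0                                  ∎
  where open ≡-Reasoning

succMod-cases : ∀ {n} (i : Fin n) →
                (suc (toℕ i) < n × toℕ (succMod i) ≡ suc (toℕ i)) ⊎
                (suc (toℕ i) ≡ n × toℕ (succMod i) ≡ 0)
succMod-cases i with ℕ.m≤n⇒m<n∨m≡n (Fin.toℕ<n i)
... | inj₁ lt = inj₁ (lt , succMod-step i lt)
... | inj₂ eq = inj₂ (eq , succMod-wrap i eq)

succMod-injective : ∀ {n} → Injective _≡_ _≡_ (succMod {n})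
succMod-injective {x = i} {j} eq with succMod-cases i | succMod-cases j
... | inj₁ (_ , p) | inj₁ (_ , q) = Fin.toℕ-injective (ℕ.suc-injective (trans (sym p) (trans (cong toℕ eq) q)))
... | inj₂ (p , _) | inj₂ (q , _) = Fin.toℕ-injective (ℕ.suc-injective (trans p (sym q)))
... | inj₁ (_ , p) | inj₂ (_ , q) = contradiction (trans (sym p) (trans (cong toℕ eq) q)) λ ()
... | inj₂ (_ , p) | inj₁ (_ , q) = contradiction (trans (sym p) (trans (cong toℕ eq) q)) λ ()

succMod≢ : ∀ {n} → 2 ≤ n → (i : Fin n) → succMod i ≢ i
succMod≢ 2≤n i eq with succMod-cases i
... | inj₁ (_ , p) = ℕ.1+n≢n (trans (sym p) (cong toℕ eq))
... | inj₂ (p , q) = ℕ.<⇒≢ 2≤n (trans (cong suc (trans (sym q) (cong toℕ eq))) p)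

-- For `n = 2` the successor would be an involution. Excluding this keeps the two cycle edges at a
-- vertex distinct.
succMod²≢ : ∀ {n} → 3 ≤ n → (i : Fin n) → succMod (succMod i) ≢ i
succMod²≢ 3≤n i eq with succMod-cases i | succMod-cases (succMod i)
... | inj₁ (_ , p) | inj₁ (_ , q) = ℕ.m≢1+m+n (toℕ i) {1} (trans (cong toℕ (sym eq)) (trans q (trans (cong suc p) (cong suc (ℕ.+-comm 1 _)))))
... | inj₁ (_ , p) | inj₂ (r , q) = ℕ.<⇒≢ 3≤n (trans (cong (λ x → suc (suc x)) (trans (sym q) (cong toℕ eq))) (trans (cong suc (sym p)) r))
... | inj₂ (r , p) | inj₁ (_ , q) = ℕ.<⇒≢ 3≤n (trans (cong (suc) (trans (cong suc (sym p)) (trans (sym q) (cong toℕ eq)))) r)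
... | inj₂ (_ , p) | inj₂ (r , _) = ℕ.<⇒≢ (ℕ.<-trans (ℕ.n<1+n 1) 3≤n) (trans (cong suc (sym p)) r)

Incident : ∀ {n m} → Graph n m → Fin m → Fin n → Set
Incident G e v = proj₁ (ends G e) ≡ v ⊎ proj₂ (ends G e) ≡ v

SameEnds-sym : ∀ {n} (p q : Fin n × Fin n) → SameEnds p q → SameEnds q p
SameEnds-sym p q (inj₁ (a , b)) = inj₁ (sym a , sym b)
SameEnds-sym p q (inj₂ (a , b)) = inj₂ (sym b , sym a)

SameEnds-trans : ∀ {n} (p q r : Fin n × Fin n) → SameEnds p q → SameEnds q r → SameEnds p r
SameEnds-trans p q r (inj₁ (refl , refl)) s = s
SameEnds-trans p q r (inj₂ (refl , refl)) (inj₁ (a , b)) = inj₂ (b , a)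
SameEnds-trans p q r (inj₂ (refl , refl)) (inj₂ (a , b)) = inj₁ (b , a)

module _ {n m} (G : Graph n m) where

  Joins-unique : ∀ {e f u v} → Joins G e u v → Joins G f u v → e ≡ f
  Joins-unique {e} {f} {u} {v} p q =
    simple G e f (SameEnds-trans (ends G e) (u , v) (ends G f) p (SameEnds-sym (ends G f) (u , v) q))

  Joins-sym : ∀ {e u v} → Joins G e u v → Joins G e v u
  Joins-sym (inj₁ (a , b)) = inj₂ (a , b)
  Joins-sym (inj₂ (a , b)) = inj₁ (a , b)

  Joins⇒Incidentˡ : ∀ {e u v} → Joins G e u v → Incident G e u
  Joins⇒Incidentˡ (inj₁ (a , _)) = inj₁ a
  Joins⇒Incidentˡ (inj₂ (_ , b)) = inj₂ b

  Joins⇒Incidentʳ : ∀ {e u v} → Joins G e u v → Incident G e v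
  Joins⇒Incidentʳ (inj₁ (_ , b)) = inj₂ b
  Joins⇒Incidentʳ (inj₂ (a , _)) = inj₁ a

  Joins-Incident : ∀ {e u v w} → Joins G e u v → Incident G e w → u ≡ w ⊎ v ≡ w
  Joins-Incident (inj₁ (refl , refl)) i        = i
  Joins-Incident (inj₂ (refl , refl)) (inj₁ i) = inj₂ i
  Joins-Incident (inj₂ (refl , refl)) (inj₂ i) = inj₁ i

  HC-from-edges : ∀ {S} → 3 ≤ n → (σ : Fin n → Fin n) → Injective _≡_ _≡_ σ →
                  (f : Fin n → Fin m) → (∀ i → Joins G (f i) (σ i) (σ (succMod i))) →
                  (∀ i → f i ∈ S) → (∀ e → e ∈ S → ∃[ i ] f i ≡ e) → IsHC G S
  HC-from-edges {S} 3≤n σ σ-inj f f-joins f∈S S⊆f =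
    3≤n , σ , σ-inj , (λ i → f i , f-joins i) , λ e → record
      { to        = λ e∈S → to (S⊆f e e∈S)
      ; from      = λ (i , j) → subst (_∈ S) (Joins-unique (f-joins i) j) (f∈S i)
      ; to-cong   = λ { refl → refl }
      ; from-cong = λ { refl → refl }
      }
    where
    to : ∀ {e} → ∃[ i ] f i ≡ e → ∃[ i ] Joins G e (σ i) (σ (succMod i))
    to (i , refl) = i , f-joins i

  -- Every vertex is `σ (succMod j)` for some `j`; indexing it by its predecessor gives direct
  -- access to the arriving edge `j` and the leaving edge `succMod j`.
  HC-edges-at : ∀ {S} → IsHC G S → ∀ v → ∃₂ λ e₁ e₂ → e₁ ≢ e₂ ×
                (e₁ ∈ S × Incident G e₁ v) × (e₂ ∈ S × Incident G e₂ v) ×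
                (∀ e → e ∈ S → Incident G e v → e ≡ e₁ ⊎ e ≡ e₂)
  HC-edges-at {S} (3≤n , σ , σ-inj , edge , S⇔) v
    with j , refl ← injective⇒surjective {f = σ ∘ succMod} (succMod-injective ∘ σ-inj) v
    = e₁ , e₂ , e₁≢e₂ , (used (succMod j) , Joins⇒Incidentˡ J₁) , (used j , Joins⇒Incidentʳ J₂) , only
    where
    e₁ = proj₁ (edge (succMod j))
    e₂ = proj₁ (edge j)
    J₁ = proj₂ (edge (succMod j))
    J₂ = proj₂ (edge j)
    used : ∀ i → proj₁ (edge i) ∈ S
    used i = Equivalence.from (S⇔ _) (i , proj₂ (edge i))
    e₁≢e₂ : e₁ ≢ e₂
    e₁≢e₂ eq with Joins-Incident J₂ (subst (λ e → Incident G e _) eq (Joins⇒Incidentʳ J₁))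
    ... | inj₁ p = succMod²≢ 3≤n j (sym (σ-inj p))
    ... | inj₂ p = succMod≢ (ℕ.<⇒≤ 3≤n) (succMod j) (sym (σ-inj p))
    only : ∀ e → e ∈ S → Incident G e (σ (succMod j)) → e ≡ e₁ ⊎ e ≡ e₂
    only e e∈S inc with i , J ← Equivalence.to (S⇔ e) e∈S with Joins-Incident J inc
    ... | inj₁ p with refl ← σ-inj p = inj₁ (Joins-unique J J₁)
    ... | inj₂ p with refl ← succMod-injective (σ-inj p) = inj₂ (Joins-unique J J₂)

  -- Two distinct edges of `S` meet `v`, so if only two candidates remain, both are used. The
  -- candidates are restricted to `S`, so the lemma also serves at vertices of degree three once one
  -- edge is known to be absent.
  HC-forced : ∀ {S} → IsHC G S → ∀ v {p q} →
              (∀ e → e ∈ S → Incident G e v → e ≡ p ⊎ e ≡ q) → p ∈ S × q ∈ S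
  HC-forced hc v only with HC-edges-at hc v
  ... | e₁ , e₂ , e₁≢e₂ , (∈₁ , i₁) , (∈₂ , i₂) , _ with only e₁ ∈₁ i₁ | only e₂ ∈₂ i₂
  ... | inj₁ refl | inj₂ refl = ∈₁ , ∈₂
  ... | inj₂ refl | inj₁ refl = ∈₂ , ∈₁
  ... | inj₁ refl | inj₁ refl = contradiction refl e₁≢e₂
  ... | inj₂ refl | inj₂ refl = contradiction refl e₁≢e₂

  HC-excluded : ∀ {S} → IsHC G S → ∀ v {p q t} → p ≢ q → p ≢ t → q ≢ t →
                Incident G p v → Incident G q v → Incident G t v →
                p ∈ S → q ∈ S → t ∉ S
  HC-excluded hc v p≢q p≢t q≢t ip iq it p∈S q∈S t∈S with HC-edges-at hc v
  ... | _ , _ , _ , _ , _ , only with only _ p∈S ip | only _ q∈S iq | only _ t∈S it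
  ... | inj₁ refl | inj₁ refl | _         = p≢q refl
  ... | inj₂ refl | inj₂ refl | _         = p≢q refl
  ... | inj₁ refl | inj₂ refl | inj₁ refl = p≢t refl
  ... | inj₁ refl | inj₂ refl | inj₂ refl = q≢t refl
  ... | inj₂ refl | inj₁ refl | inj₁ refl = q≢t refl
  ... | inj₂ refl | inj₁ refl | inj₂ refl = p≢t refl

-- Treewidth

∣p∪q∣≤∣p∣+∣q∣ : ∀ {n} (p q : Subset n) → ∣ p ∪ q ∣ ≤ ∣ p ∣ + ∣ q ∣
∣p∪q∣≤∣p∣+∣q∣ []          []          = z≤n
∣p∪q∣≤∣p∣+∣q∣ (true ∷ p)  (true ∷ q)  = s≤s (ℕ.≤-trans (∣p∪q∣≤∣p∣+∣q∣ p q) (ℕ.+-monoʳ-≤ ∣ p ∣ (ℕ.n≤1+n _)))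
∣p∪q∣≤∣p∣+∣q∣ (true ∷ p)  (false ∷ q) = s≤s (∣p∪q∣≤∣p∣+∣q∣ p q)
∣p∪q∣≤∣p∣+∣q∣ (false ∷ p) (true ∷ q)  =
  ℕ.≤-trans (s≤s (∣p∪q∣≤∣p∣+∣q∣ p q)) (ℕ.≤-reflexive (sym (ℕ.+-suc ∣ p ∣ ∣ q ∣)))
∣p∪q∣≤∣p∣+∣q∣ (false ∷ p) (false ∷ q) = ∣p∪q∣≤∣p∣+∣q∣ p q

∣p∣≤length : ∀ {n} {p : Subset n} (vs : List (Fin n)) → (∀ {v} → v ∈ p → v List.∈ vs) → ∣ p ∣ ≤ length vs
∣p∣≤length {n} {p} vs p⊆vs = ℕ.≤-trans (p⊆q⇒∣p∣≤∣q∣ (⊆⋃ vs ∘ p⊆vs)) (size vs)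
  where
  ⊆⋃ : ∀ vs {v} → v List.∈ vs → v ∈ ⋃ (map ⁅_⁆ vs)
  ⊆⋃ (w ∷ vs) (here refl) = x∈p∪q⁺ (inj₁ (x∈⁅x⁆ w))
  ⊆⋃ (w ∷ vs) (there v∈)  = x∈p∪q⁺ (inj₂ (⊆⋃ vs v∈))
  size : ∀ vs → ∣ ⋃ (map ⁅_⁆ vs) ∣ ≤ length vs
  size []       = ℕ.≤-reflexive (∣⊥∣≡0 n)
  size (w ∷ vs) = ℕ.≤-trans (∣p∪q∣≤∣p∣+∣q∣ ⁅ w ⁆ _)
                            (ℕ.+-mono-≤ (ℕ.≤-reflexive (∣⁅x⁆∣≡1 w)) (size vs))

walk-snoc : ∀ {k parent P t u u'} → Walk {k} parent P t u → TreeAdj parent u u' → P u' → Walk parent P t u'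
walk-snoc (stay pt)      adj pu' = step pt adj (stay pu')
walk-snoc (step pt a w)  adj pu' = step pt a (walk-snoc w adj pu')

-- The tree is a path, and the induction removes its upper end, whose parent is its predecessor.
-- Both directions are built together because a `Walk` is directed, while `connected` admits its two
-- bags in either order.
path-walk : ∀ {k} {P : Fin (suc k) → Set} g t t' → g + toℕ t ≡ toℕ t' →
            (∀ s → toℕ t ≤ toℕ s → toℕ s ≤ toℕ t' → P s) →
            Walk inject₁ P t t' × Walk inject₁ P t' t
path-walk zero t t' eq P-on with refl ← Fin.toℕ-injective eq = stay p , stay p
  where p = P-on t ℕ.≤-refl ℕ.≤-refl
path-walk {P = P} (suc g) t (fsuc j) eq P-on =
  walk-snoc (proj₁ rec) (j , inj₂ (refl , refl)) p , step p (j , inj₁ (refl , refl)) (proj₂ rec)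
  where
  g+t≡j : g + toℕ t ≡ toℕ (inject₁ j)
  g+t≡j = trans (ℕ.suc-injective eq) (sym (Fin.toℕ-inject₁ j))
  p : P (fsuc j)
  p = P-on (fsuc j) (ℕ.≤-trans (ℕ.m≤n+m (toℕ t) (suc g)) (ℕ.≤-reflexive eq)) ℕ.≤-refl
  rec = path-walk g t (inject₁ j) g+t≡j
          (λ s t≤s s≤j → P-on s t≤s (ℕ.m≤n⇒m≤1+n (ℕ.≤-trans s≤j (ℕ.≤-reflexive (Fin.toℕ-inject₁ j)))))

does⇒ : ∀ {A : Set} (a? : Dec A) → does a? ≡ true → A
does⇒ (yes a) _ = a

gap : ∀ {m n} → m ≤ n → ∃[ o ] o + m ≡ n
gap m≤n = _ , ℕ.m∸n+n≡m m≤n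

-- Bag `t` consists of vertex 0 and the window from `t - 3` to `t`, five vertices at most. Having 0
-- in every bag takes care of the edge that closes the cycle.
InBag : ∀ {n} → Fin n → Fin n → Set
InBag t v = toℕ v ≡ 0 ⊎ (toℕ v ≤ toℕ t × toℕ t ≤ 3 + toℕ v)

inBag? : ∀ {n} (t v : Fin n) → Dec (InBag t v)
inBag? t v = (toℕ v ≟ 0) ⊎-dec ((toℕ v ≤? toℕ t) ×-dec (toℕ t ≤? 3 + toℕ v))

toℕ-pred : ∀ {n} (t : Fin n) {x} → toℕ t ≡ suc x → toℕ (pred t) ≡ x
toℕ-pred (fsuc t) eq = trans (Fin.toℕ-inject₁ t) (ℕ.suc-injective eq)

-- Vertex 0 lies in all bags and any other `v` in the consecutive bags `v` to `v + 3`, so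
-- connectedness is convexity of an interval.
band-decomposition : ∀ {n m} → 1 ≤ n → (G : Graph n m) →
  (∀ e → ∃[ t ] (InBag t (proj₁ (ends G e)) × InBag t (proj₂ (ends G e)))) →
  TreewidthAtMost G 4
band-decomposition {suc n} _ G banded = record
  { size       = n
  ; parent     = inject₁
  ; parent-<   = λ j → ℕ.≤-reflexive (Fin.toℕ-inject₁ j)
  ; bag        = bag
  -- `pred` stops at 0, so for small `t` the list merely repeats vertices.
  ; bag-size   = λ t → ∣p∣≤length (fzero ∷ t ∷ pred t ∷ pred (pred t) ∷ pred (pred (pred t)) ∷ []) (covered t)
  ; cover-vert = λ v → v , ∈bag v v (inj₂ (ℕ.≤-refl , ℕ.m≤n+m _ 3))
  ; cover-edge = λ e → let t , p , q = banded e in t , ∈bag t _ p , ∈bag t _ q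
  ; connected  = connected
  }
  where
  bag : Fin (suc n) → Subset (suc n)
  bag t = tabulate (λ v → does (inBag? t v))

  ∈bag : ∀ t v → InBag t v → v ∈ bag t
  ∈bag t v p = lookup⇒[]= v (bag t) (trans (lookup∘tabulate (λ v → does (inBag? t v)) v) (dec-true (inBag? t v) p))

  bag∋ : ∀ t v → v ∈ bag t → InBag t v
  bag∋ t v v∈ = does⇒ (inBag? t v) (trans (sym (lookup∘tabulate (λ v → does (inBag? t v)) v)) ([]=⇒lookup v∈))

  covered : ∀ t {v} → v ∈ bag t → v List.∈ (fzero ∷ t ∷ pred t ∷ pred (pred t) ∷ pred (pred (pred t)) ∷ [])
  covered t {v} v∈ with bag∋ t v v∈
  ... | inj₁ v≡0 = here (Fin.toℕ-injective v≡0)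
  ... | inj₂ (v≤t , t≤3+v) with gap v≤t
  ...   | 0 , eq = there (here (Fin.toℕ-injective eq))
  ...   | 1 , eq = there (there (here (Fin.toℕ-injective (sym (toℕ-pred t (sym eq))))))
  ...   | 2 , eq = there (there (there (here (Fin.toℕ-injective
                     (sym (toℕ-pred (pred t) (toℕ-pred t (sym eq))))))))
  ...   | 3 , eq = there (there (there (there (here (Fin.toℕ-injective
                     (sym (toℕ-pred (pred (pred t)) (toℕ-pred (pred t) (toℕ-pred t (sym eq))))))))))
  ...   | suc (suc (suc (suc o))) , eq = contradiction
            (ℕ.≤-trans (s≤s (ℕ.m≤n+m _ o)) (ℕ.+-cancelˡ-≤ 3 _ _ (ℕ.≤-trans (ℕ.≤-reflexive eq) t≤3+v)))
            (ℕ.n≮n _)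

  convex : ∀ v t t' s → InBag t v → InBag t' v → toℕ t ≤ toℕ s → toℕ s ≤ toℕ t' → InBag s v
  convex v t t' s (inj₁ v≡0)       _                  _   _    = inj₁ v≡0
  convex v t t' s (inj₂ _)         (inj₁ v≡0)         _   _    = inj₁ v≡0
  convex v t t' s (inj₂ (v≤t , _)) (inj₂ (_ , t'≤v3)) t≤s s≤t' =
    inj₂ (ℕ.≤-trans v≤t t≤s , ℕ.≤-trans s≤t' t'≤v3)

  walks : ∀ v t t' → v ∈ bag t → v ∈ bag t' → toℕ t ≤ toℕ t' →
          Walk inject₁ (λ s → v ∈ bag s) t t' × Walk inject₁ (λ s → v ∈ bag s) t' t
  walks v t t' v∈t v∈t' t≤t' = let g , eq = gap t≤t' in
    path-walk g t t' eq λ s t≤s s≤t' → ∈bag s v (convex v t t' s (bag∋ t v v∈t) (bag∋ t' v v∈t') t≤s s≤t')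

  connected : ∀ v t t' → v ∈ bag t → v ∈ bag t' → Walk inject₁ (λ s → v ∈ bag s) t t'
  connected v t t' v∈t v∈t' with ℕ.≤-total (toℕ t) (toℕ t')
  ... | inj₁ t≤t' = proj₁ (walks v t t' v∈t v∈t' t≤t')
  ... | inj₂ t'≤t = proj₂ (walks v t' t v∈t' v∈t t'≤t)

-- The ladder

double : ℕ → ℕ
double zero    = zero
double (suc n) = suc (suc (double n))

double-mono : ∀ {i j} → i ≤ j → double i ≤ double j
double-mono z≤n       = z≤n
double-mono (s≤s i≤j) = s≤s (s≤s (double-mono i≤j))

double-injective : ∀ {i j} → double i ≡ double j → i ≡ j
double-injective {zero}  {zero}  _  = refl
double-injective {suc i} {suc j} eq = cong suc (double-injective (ℕ.suc-injective (ℕ.suc-injective eq)))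

double≢1+double : ∀ i j → double i ≢ suc (double j)
double≢1+double (suc i) zero ()
double≢1+double (suc i) (suc j) eq = double≢1+double i j (ℕ.suc-injective (ℕ.suc-injective eq))

parity : ∀ x → (∃[ h ] x ≡ double h) ⊎ (∃[ h ] x ≡ suc (double h))
parity zero = inj₁ (0 , refl)
parity (suc x) with parity x
... | inj₁ (h , refl) = inj₂ (h , refl)
... | inj₂ (h , refl) = inj₁ (suc h , refl)

-- The cycle runs through 0, 1, …, n-1. For i < K the odd vertex 2i+1 and the even vertex 2i+2 form a rung.
-- Chord j runs from 2j-1 (from 0 if j = 0) to 2j+2 (to 2K+1 if j = K), and the vertices from 2K+1 on
-- form the return path to 0.
module Ladder (K n : ℕ) (1≤K : 1 ≤ K) (room : 3 + double K ≤ n) where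

  low high : ℕ → ℕ
  low zero    = 0
  low (suc i) = suc (double i)
  high j = (2 + double j) ⊓ suc (double K)

  -- Spanning at least two keeps a chord from being parallel to an edge of the cycle. For chord 0
  -- this rests on `1 ≤ K`, without which its upper end would be 1.
  2+low≤high : ∀ j → j ≤ K → 2 + low j ≤ high j
  2+low≤high zero    j≤K = ℕ.⊓-glb ℕ.≤-refl (s≤s (ℕ.≤-trans (ℕ.n≤1+n 1) (double-mono 1≤K)))
  2+low≤high (suc i) j≤K = ℕ.⊓-glb (ℕ.n≤1+n _) (s≤s (double-mono j≤K))

  -- Spanning at most three lets a chord fit into the bag of its upper end.
  high≤3+low : ∀ j → high j ≤ 3 + low j
  high≤3+low zero    = ℕ.≤-trans (ℕ.m⊓n≤m 2 _) (ℕ.n≤1+n _)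
  high≤3+low (suc i) = ℕ.m⊓n≤m _ _

  high≤ : ∀ j → high j ≤ suc (double K)
  high≤ j = ℕ.m⊓n≤n (2 + double j) _

  high-< : ∀ {j} → j < K → high j ≡ 2 + double j
  high-< {j} j<K = ℕ.m≤n⇒m⊓n≡m (ℕ.m≤n⇒m≤1+n (double-mono j<K))

  high-top : high K ≡ suc (double K)
  high-top = ℕ.m≥n⇒m⊓n≡n (ℕ.n≤1+n _)

  low-injective : ∀ {i j} → low i ≡ low j → i ≡ j
  low-injective {zero}  {zero}  _  = refl
  low-injective {suc i} {suc j} eq = cong suc (double-injective (ℕ.suc-injective eq))

  toℕ≤K : (j : Fin (suc K)) → toℕ j ≤ K
  toℕ≤K j = ℕ.≤-pred (Fin.toℕ<n j)

  1+2K<n : suc (double K) < n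
  1+2K<n = ℕ.≤-trans (ℕ.n≤1+n _) room

  3≤n : 3 ≤ n
  3≤n = ℕ.≤-trans (s≤s (s≤s (s≤s z≤n))) room

  even< : (j : Fin (suc K)) → double (toℕ j) < n
  even< j = ℕ.≤-<-trans (ℕ.m≤n⇒m≤1+n (double-mono (toℕ≤K j))) 1+2K<n

  odd< : (i : Fin K) → suc (double (toℕ i)) < n
  odd< i = ℕ.≤-<-trans (s≤s (double-mono (ℕ.<⇒≤ (Fin.toℕ<n i)))) 1+2K<n

  high<n : (j : Fin (suc K)) → high (toℕ j) < n
  high<n j = ℕ.≤-<-trans (high≤ (toℕ j)) 1+2K<n

  low<n : (j : Fin (suc K)) → low (toℕ j) < n
  low<n j = ℕ.≤-<-trans (ℕ.≤-trans (ℕ.m≤n+m _ 2) (2+low≤high (toℕ j) (toℕ≤K j))) (high<n j)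

  even lo hi : Fin (suc K) → Fin n
  even j = fromℕ< (even< j)
  lo j   = fromℕ< (low<n j)
  hi j   = fromℕ< (high<n j)

  odd : Fin K → Fin n
  odd i = fromℕ< (odd< i)

  toℕ-even : ∀ j → toℕ (even j) ≡ double (toℕ j)
  toℕ-even j = Fin.toℕ-fromℕ< _

  toℕ-odd : ∀ i → toℕ (odd i) ≡ suc (double (toℕ i))
  toℕ-odd i = Fin.toℕ-fromℕ< _

  toℕ-lo : ∀ j → toℕ (lo j) ≡ low (toℕ j)
  toℕ-lo j = Fin.toℕ-fromℕ< _

  toℕ-hi : ∀ j → toℕ (hi j) ≡ high (toℕ j)
  toℕ-hi j = Fin.toℕ-fromℕ< _

  lo+2≤hi : ∀ j → 2 + toℕ (lo j) ≤ toℕ (hi j)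
  lo+2≤hi j = subst₂ (λ x y → 2 + x ≤ y) (sym (toℕ-lo j)) (sym (toℕ-hi j)) (2+low≤high (toℕ j) (toℕ≤K j))

  hi≤ : ∀ j → toℕ (hi j) ≤ suc (double K)
  hi≤ j = subst (_≤ suc (double K)) (sym (toℕ-hi j)) (high≤ (toℕ j))

  hi≤lo+3 : ∀ j → toℕ (hi j) ≤ 3 + toℕ (lo j)
  hi≤lo+3 j = subst₂ (λ x y → x ≤ 3 + y) (sym (toℕ-hi j)) (sym (toℕ-lo j)) (high≤3+low (toℕ j))

  lo<hi : ∀ j → toℕ (lo j) < toℕ (hi j)
  lo<hi j = ℕ.≤-trans (ℕ.n≤1+n _) (lo+2≤hi j)

  lo-injective : ∀ {i j} → lo i ≡ lo j → i ≡ j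
  lo-injective {i} {j} eq = Fin.toℕ-injective (low-injective (trans (sym (toℕ-lo i)) (trans (cong toℕ eq) (toℕ-lo j))))

  even-injective : Injective _≡_ _≡_ even
  even-injective {i} {j} eq = Fin.toℕ-injective (double-injective
    (trans (sym (toℕ-even i)) (trans (cong toℕ eq) (toℕ-even j))))

  odd-injective : Injective _≡_ _≡_ odd
  odd-injective {i} {j} eq = Fin.toℕ-injective (double-injective (ℕ.suc-injective
    (trans (sym (toℕ-odd i)) (trans (cong toℕ eq) (toℕ-odd j)))))

  even≢odd : ∀ j i → even j ≢ odd i
  even≢odd j i eq = double≢1+double (toℕ j) (toℕ i) (trans (sym (toℕ-even j)) (trans (cong toℕ eq) (toℕ-odd i)))

  Far : Fin n → Set
  Far u = suc (double K) ≤ toℕ u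

  even-near : ∀ j → ¬ Far (even j)
  even-near j far = ℕ.<⇒≱ (s≤s (double-mono (toℕ≤K j))) (subst (suc (double K) ≤_) (toℕ-even j) far)

  odd-near : ∀ i → ¬ Far (odd i)
  odd-near i far = ℕ.<⇒≱ (ℕ.≤-trans (ℕ.n≤1+n _) (s≤s (double-mono (Fin.toℕ<n i)))) (subst (suc (double K) ≤_) (toℕ-odd i) far)

  data Position (u : Fin n) : Set where
    at-even : ∀ j → even j ≡ u → Position u
    at-odd  : ∀ i → odd i ≡ u → Position u
    far     : Far u → Position u

  position : ∀ u → Position u
  position u with parity (toℕ u)
  ... | inj₁ (h , eq) with h ≤? K
  ...   | yes h≤K = at-even (fromℕ< (s≤s h≤K)) (Fin.toℕ-injective
            (trans (toℕ-even _) (trans (cong double (Fin.toℕ-fromℕ< (s≤s h≤K))) (sym eq))))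
  ...   | no  h≰K = far (ℕ.≤-trans (ℕ.n≤1+n _) (ℕ.≤-trans (double-mono (ℕ.≰⇒> h≰K)) (ℕ.≤-reflexive (sym eq))))
  position u | inj₂ (h , eq) with h <? K
  ...   | yes h<K = at-odd (fromℕ< h<K) (Fin.toℕ-injective
            (trans (toℕ-odd _) (trans (cong (suc ∘ double) (Fin.toℕ-fromℕ< h<K)) (sym eq))))
  ...   | no  h≮K = far (ℕ.≤-trans (s≤s (double-mono (ℕ.≮⇒≥ h≮K))) (ℕ.≤-reflexive (sym eq)))

  -- Functions on the vertices are given by their values on the three kinds of position.
  -- `position (even j)` does not reduce, so the equations for such a function need lemmas;
  -- injectivity of `even` and `odd` identifies the index that `position` returns.
  module Cases {X : Set} (a : Fin (suc K) → X) (b : Fin K → X) (c : Fin n → X) where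

    cases : Fin n → X
    cases u with position u
    ... | at-even j _ = a j
    ... | at-odd i _  = b i
    ... | far _       = c u

    cases-even : ∀ j → cases (even j) ≡ a j
    cases-even j with position (even j)
    ... | at-even j' eq = cong a (even-injective eq)
    ... | at-odd i eq   = contradiction (sym eq) (even≢odd j i)
    ... | far f         = contradiction f (even-near j)

    cases-odd : ∀ i → cases (odd i) ≡ b i
    cases-odd i with position (odd i)
    ... | at-even j eq = contradiction eq (even≢odd j i)
    ... | at-odd i' eq = cong b (odd-injective eq)
    ... | far f        = contradiction f (odd-near i)

    cases-far : ∀ u → Far u → cases u ≡ c u
    cases-far u f with position u
    ... | at-even j refl = contradiction f (even-near j)
    ... | at-odd i refl  = contradiction f (odd-near i)
    ... | far _          = refl

  succ-even : ∀ i → succMod (even (inject₁ i)) ≡ odd i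
  succ-even i = Fin.toℕ-injective (begin
    toℕ (succMod (even (inject₁ i)))  ≡⟨ succMod-step _ (subst (λ x → suc x < n) (sym eq) (odd< i)) ⟩
    suc (toℕ (even (inject₁ i)))      ≡⟨ cong suc eq ⟩
    suc (double (toℕ i))              ≡⟨ toℕ-odd i ⟨
    toℕ (odd i)                       ∎)
    where
    open ≡-Reasoning
    eq : toℕ (even (inject₁ i)) ≡ double (toℕ i)
    eq = trans (toℕ-even (inject₁ i)) (cong double (Fin.toℕ-inject₁ i))

  succ-odd : ∀ i → succMod (odd i) ≡ even (fsuc i)
  succ-odd i = Fin.toℕ-injective (begin
    toℕ (succMod (odd i))   ≡⟨ succMod-step _ (subst (λ x → suc x < n) (sym (toℕ-odd i)) (even< (fsuc i))) ⟩
    suc (toℕ (odd i))       ≡⟨ cong suc (toℕ-odd i) ⟩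
    double (suc (toℕ i))    ≡⟨ toℕ-even (fsuc i) ⟨
    toℕ (even (fsuc i))     ∎)
    where open ≡-Reasoning

  succ-even-top : succMod (even (fromℕ K)) ≡ hi (fromℕ K)
  succ-even-top = Fin.toℕ-injective (begin
    toℕ (succMod (even (fromℕ K)))  ≡⟨ succMod-step _ (subst (λ x → suc x < n) (sym eq) 1+2K<n) ⟩
    suc (toℕ (even (fromℕ K)))      ≡⟨ cong suc eq ⟩
    suc (double K)                  ≡⟨ high-top ⟨
    high K                          ≡⟨ cong high (Fin.toℕ-fromℕ K) ⟨
    high (toℕ (fromℕ K))            ≡⟨ toℕ-hi (fromℕ K) ⟨
    toℕ (hi (fromℕ K))              ∎)
    where
    open ≡-Reasoning
    eq : toℕ (even (fromℕ K)) ≡ double K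
    eq = trans (toℕ-even (fromℕ K)) (cong double (Fin.toℕ-fromℕ K))

  lo-zero : lo fzero ≡ even fzero
  lo-zero = Fin.toℕ-injective (trans (toℕ-lo fzero) (sym (toℕ-even fzero)))

  lo-suc : ∀ i → lo (fsuc i) ≡ odd i
  lo-suc i = Fin.toℕ-injective (trans (toℕ-lo (fsuc i)) (sym (toℕ-odd i)))

  hi-inject₁ : ∀ i → hi (inject₁ i) ≡ even (fsuc i)
  hi-inject₁ i = Fin.toℕ-injective (begin
    toℕ (hi (inject₁ i))       ≡⟨ toℕ-hi (inject₁ i) ⟩
    high (toℕ (inject₁ i))     ≡⟨ cong high (Fin.toℕ-inject₁ i) ⟩
    high (toℕ i)               ≡⟨ high-< (Fin.toℕ<n i) ⟩
    2 + double (toℕ i)         ≡⟨ toℕ-even (fsuc i) ⟨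
    toℕ (even (fsuc i))        ∎)
    where open ≡-Reasoning

  hi-top-far : Far (hi (fromℕ K))
  hi-top-far = ℕ.≤-reflexive (trans (sym high-top) (trans (cong high (sym (Fin.toℕ-fromℕ K))) (sym (toℕ-hi (fromℕ K)))))

  -- The graph and its treewidth

  endpoints : Fin n ⊎ Fin (suc K) → Fin n × Fin n
  endpoints (inj₁ i) = i , succMod i
  endpoints (inj₂ j) = lo j , hi j

  endpoints-distinct : ∀ e → proj₁ (endpoints e) ≢ proj₂ (endpoints e)
  endpoints-distinct (inj₁ i) eq = succMod≢ (ℕ.<⇒≤ 3≤n) i (sym eq)
  endpoints-distinct (inj₂ j) eq = ℕ.<⇒≢ (lo<hi j) (cong toℕ eq)

  cycle≁chord : ∀ i j → ¬ SameEnds (i , succMod i) (lo j , hi j)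
  cycle≁chord i j (inj₁ (refl , eq)) with succMod-cases (lo j)
  ... | inj₁ (_ , p) = ℕ.<⇒≢ (lo+2≤hi j) (trans (sym p) (cong toℕ eq))
  ... | inj₂ (_ , p) = ℕ.<⇒≢ (ℕ.≤-trans (s≤s z≤n) (lo<hi j)) (trans (sym p) (cong toℕ eq))
  cycle≁chord i j (inj₂ (refl , eq)) with succMod-cases (hi j)
  ... | inj₁ (_ , p) = ℕ.<-asym (lo<hi j) (ℕ.≤-reflexive (trans (sym p) (cong toℕ eq)))
  -- The closing edge starts at `n - 1`, which `room` puts beyond every end of a chord.
  ... | inj₂ (p , _) = ℕ.<⇒≢ (ℕ.≤-trans (s≤s (s≤s (hi≤ j))) room) p

  endpoints-simple : ∀ e f → SameEnds (endpoints e) (endpoints f) → e ≡ f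
  endpoints-simple (inj₁ i) (inj₁ i') (inj₁ (eq , _))    = cong inj₁ eq
  endpoints-simple (inj₁ i) (inj₁ i') (inj₂ (refl , eq)) = contradiction eq (succMod²≢ 3≤n i')
  endpoints-simple (inj₁ i) (inj₂ j)  same               = contradiction same (cycle≁chord i j)
  endpoints-simple (inj₂ j) (inj₁ i)  same               =
    contradiction (SameEnds-sym (lo j , hi j) (i , succMod i) same) (cycle≁chord i j)
  endpoints-simple (inj₂ j) (inj₂ j') (inj₁ (eq , _))    = cong inj₂ (lo-injective eq)
  endpoints-simple (inj₂ j) (inj₂ j') (inj₂ (p , q))     = contradiction
    (ℕ.<-trans (lo<hi j) (subst₂ _<_ (cong toℕ (sym q)) (cong toℕ (sym p)) (lo<hi j')))
    (ℕ.<-irrefl refl)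

  ladder : Graph n (n + suc K)
  ladder = record
    { ends     = endpoints ∘ splitAt n
    ; loopless = endpoints-distinct ∘ splitAt n
    ; simple   = λ e f same → begin
        e                              ≡⟨ Fin.join-splitAt n (suc K) e ⟨
        join n (suc K) (splitAt n e)   ≡⟨ cong (join n (suc K)) (endpoints-simple (splitAt n e) (splitAt n f) same) ⟩
        join n (suc K) (splitAt n f)   ≡⟨ Fin.join-splitAt n (suc K) f ⟩
        f                              ∎
    }
    where open ≡-Reasoning

  cyc : Fin n → Fin (n + suc K)
  cyc i = i ↑ˡ suc K

  chord : Fin (suc K) → Fin (n + suc K)
  chord j = n ↑ʳ j

  cyc-joins : ∀ i → Joins ladder (cyc i) i (succMod i)
  cyc-joins i rewrite Fin.splitAt-↑ˡ n i (suc K) = inj₁ (refl , refl)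

  chord-joins : ∀ j → Joins ladder (chord j) (lo j) (hi j)
  chord-joins j rewrite Fin.splitAt-↑ʳ n (suc K) j = inj₁ (refl , refl)

  cyc-injective : Injective _≡_ _≡_ cyc
  cyc-injective = Fin.↑ˡ-injective (suc K) _ _

  chord-injective : Injective _≡_ _≡_ chord
  chord-injective = Fin.↑ʳ-injective n _ _

  cyc≢chord : ∀ i j → cyc i ≢ chord j
  cyc≢chord i j eq with trans (sym (Fin.splitAt-↑ˡ n i (suc K))) (trans (cong (splitAt n) eq) (Fin.splitAt-↑ʳ n (suc K) j))
  ... | ()

  data Edge : Fin (n + suc K) → Set where
    cycᵉ   : ∀ i → Edge (cyc i)
    chordᵉ : ∀ j → Edge (chord j)

  edge : ∀ e → Edge e
  edge e = subst Edge (Fin.join-splitAt n (suc K) e) (joined (splitAt n e))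
    where
    joined : ∀ s → Edge (join n (suc K) s)
    joined (inj₁ i) = cycᵉ i
    joined (inj₂ j) = chordᵉ j

  -- Every edge other than the closing one lies in the bag of its upper end; the closing edge lies
  -- in bag `n - 1`, because 0 lies in every bag.
  ladder-treewidth : TreewidthAtMost ladder 4
  ladder-treewidth = band-decomposition (ℕ.≤-trans (s≤s z≤n) 3≤n) ladder λ e → banded (splitAt n e)
    where
    banded : ∀ e → ∃[ t ] (InBag t (proj₁ (endpoints e)) × InBag t (proj₂ (endpoints e)))
    banded (inj₁ i) with succMod-cases i
    ... | inj₁ (_ , p) = succMod i ,
            inj₂ (ℕ.≤-trans (ℕ.n≤1+n _) (ℕ.≤-reflexive (sym p)) , ℕ.≤-trans (ℕ.≤-reflexive p) (ℕ.m≤n+m _ 2)) ,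
            inj₂ (ℕ.≤-refl , ℕ.m≤n+m _ 3)
    ... | inj₂ (_ , p) = i , inj₂ (ℕ.≤-refl , ℕ.m≤n+m _ 3) , inj₁ p
    banded (inj₂ j) = hi j , inj₂ (ℕ.<⇒≤ (lo<hi j) , hi≤lo+3 j) , inj₂ (ℕ.≤-refl , ℕ.m≤n+m _ 3)

  -- The two Hamiltonian cycles

  select : (Fin n → Bool) → (Fin (suc K) → Bool) → Subset (n + suc K)
  select p q = tabulate ([ p , q ]′ ∘ splitAt n)

  lookup-cyc : ∀ p q i → lookup (select p q) (cyc i) ≡ p i
  lookup-cyc p q i = trans (lookup∘tabulate _ (cyc i)) (cong [ p , q ]′ (Fin.splitAt-↑ˡ n i (suc K)))

  lookup-chord : ∀ p q j → lookup (select p q) (chord j) ≡ q j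
  lookup-chord p q j = trans (lookup∘tabulate _ (chord j)) (cong [ p , q ]′ (Fin.splitAt-↑ʳ n (suc K) j))

  ≡select : ∀ {p q} S → (∀ i → lookup S (cyc i) ≡ p i) → (∀ j → lookup S (chord j) ≡ q j) → S ≡ select p q
  ≡select {p} {q} S on-cyc on-chord = trans (sym (tabulate∘lookup S)) (tabulate-cong pointwise)
    where
    pointwise : ∀ e → lookup S e ≡ [ p , q ]′ (splitAt n e)
    pointwise e with edge e
    ... | cycᵉ i   = trans (on-cyc i) (sym (cong [ p , q ]′ (Fin.splitAt-↑ˡ n i (suc K))))
    ... | chordᵉ j = trans (on-chord j) (sym (cong [ p , q ]′ (Fin.splitAt-↑ʳ n (suc K) j)))

  module OffEven = Cases {Bool} (λ _ → false) (λ _ → true) (λ _ → true)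

  offEven : Fin n → Bool
  offEven = OffEven.cases

  hcA hcB : Subset (n + suc K)
  hcA = select (λ _ → true) (λ _ → false)
  hcB = select offEven (λ _ → true)

  hcA-isHC : IsHC ladder hcA
  hcA-isHC = HC-from-edges ladder 3≤n id id cyc cyc-joins
    (λ i → lookup⇒[]= (cyc i) hcA (lookup-cyc _ _ i)) λ e → reached (edge e)
    where
    reached : ∀ {e} → Edge e → e ∈ hcA → ∃[ i ] cyc i ≡ e
    reached (cycᵉ i)   _  = i , refl
    reached (chordᵉ j) e∈ with trans (sym ([]=⇒lookup e∈)) (lookup-chord _ _ j)
    ... | ()

  -- The second cycle visits 0, 2, 1, 4, 3, ..., `2K`, `2K - 1`, `2K + 1`, ...: `reflect` swaps the
  -- ends of each rung and fixes the rest. `UsedB` names the edge of each step, namely chord `j` at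
  -- position `2j`, a rung traversed backwards at an odd position, and the return path afterwards.
  reflect-even : Fin (suc K) → Fin n
  reflect-even fzero    = even fzero
  reflect-even (fsuc i) = odd i

  module Reflect = Cases reflect-even (even ∘ fsuc) id
  module UsedB = Cases chord (cyc ∘ odd) cyc

  reflect : Fin n → Fin n
  reflect = Reflect.cases

  reflect-zero : reflect (even fzero) ≡ even fzero
  reflect-zero = Reflect.cases-even fzero

  reflect-involutive : ∀ u → reflect (reflect u) ≡ u
  reflect-involutive u with position u
  ... | at-even fzero refl    = reflect-zero
  ... | at-even (fsuc i) refl = Reflect.cases-odd i
  ... | at-odd i refl         = Reflect.cases-even (fsuc i)
  ... | far f                 = Reflect.cases-far u f

  reflect-injective : Injective _≡_ _≡_ reflect
  reflect-injective {u} {v} eq = trans (sym (reflect-involutive u)) (trans (cong reflect eq) (reflect-involutive v))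

  lo≡reflect : ∀ j → lo j ≡ reflect (even j)
  lo≡reflect fzero    = trans lo-zero (sym reflect-zero)
  lo≡reflect (fsuc i) = trans (lo-suc i) (sym (Reflect.cases-even (fsuc i)))

  hi≡reflect : ∀ j → hi j ≡ reflect (succMod (even j))
  hi≡reflect j with view j
  ... | ‵fromℕ     = sym (trans (cong reflect succ-even-top) (Reflect.cases-far _ hi-top-far))
  ... | ‵inject₁ i = trans (hi-inject₁ i) (sym (trans (cong reflect (succ-even i)) (Reflect.cases-odd i)))

  reflect-succ-far : ∀ u → Far u → reflect (succMod u) ≡ succMod u
  reflect-succ-far u f with succMod-cases u
  ... | inj₁ (_ , p) = Reflect.cases-far (succMod u) (ℕ.≤-trans (ℕ.m≤n⇒m≤1+n f) (ℕ.≤-reflexive (sym p)))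
  ... | inj₂ (_ , p) = subst (λ v → reflect v ≡ v) (sym (Fin.toℕ-injective (trans p (sym (toℕ-even fzero))))) reflect-zero

  usedB-joins : ∀ u → Joins ladder (UsedB.cases u) (reflect u) (reflect (succMod u))
  usedB-joins u with position u
  ... | at-even j refl = subst₂ (Joins ladder (chord j)) (trans (lo≡reflect j) (Reflect.cases-even j)) (hi≡reflect j) (chord-joins j)
  ... | at-odd i refl  = subst₂ (Joins ladder (cyc (odd i))) (succ-odd i)
        (sym (trans (cong reflect (succ-odd i)) (Reflect.cases-even (fsuc i))))
        (Joins-sym ladder (cyc-joins (odd i)))
  ... | far f          = subst (Joins ladder (cyc u) u) (sym (reflect-succ-far u f)) (cyc-joins u)

  hcB-isHC : IsHC ladder hcB
  hcB-isHC = HC-from-edges ladder 3≤n reflect reflect-injective UsedB.cases usedB-joins used λ e → reached (edge e)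
    where
    used : ∀ u → UsedB.cases u ∈ hcB
    used u with position u
    ... | at-even j refl = lookup⇒[]= (chord j) hcB (lookup-chord _ _ j)
    ... | at-odd i refl  = lookup⇒[]= (cyc (odd i)) hcB (trans (lookup-cyc _ _ (odd i)) (OffEven.cases-odd i))
    ... | far f          = lookup⇒[]= (cyc u) hcB (trans (lookup-cyc _ _ u) (OffEven.cases-far u f))
    reached : ∀ {e} → Edge e → e ∈ hcB → ∃[ u ] UsedB.cases u ≡ e
    reached (chordᵉ j) _  = even j , UsedB.cases-even j
    reached (cycᵉ u)   e∈ with position u
    ... | at-odd i refl  = odd i , UsedB.cases-odd i
    ... | far f          = u , UsedB.cases-far u f
    ... | at-even j refl with trans (sym ([]=⇒lookup e∈)) (trans (lookup-cyc _ _ (even j)) (OffEven.cases-even j))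
    ...   | ()

  -- No further Hamiltonian cycles

  -- Naming the vertex by its predecessor `u` makes both cycle edges at it explicit, including at 0,
  -- whose predecessor is `last`.
  incident-cases : ∀ u e → Incident ladder e (succMod u) →
                   (e ≡ cyc u ⊎ e ≡ cyc (succMod u)) ⊎
                   ∃[ j ] (e ≡ chord j × (lo j ≡ succMod u ⊎ hi j ≡ succMod u))
  incident-cases u e inc with edge e
  ... | chordᵉ j = inj₂ (j , refl , Joins-Incident ladder (chord-joins j) inc)
  ... | cycᵉ i with Joins-Incident ladder (cyc-joins i) inc
  ...   | inj₁ eq = inj₁ (inj₂ (cong cyc eq))
  ...   | inj₂ eq = inj₁ (inj₁ (cong cyc (succMod-injective eq)))

  ¬lo-even : ∀ i j → lo j ≢ even (fsuc i)
  ¬lo-even i fzero    eq with trans (sym (toℕ-even fzero)) (trans (cong toℕ (trans (sym lo-zero) eq)) (toℕ-even (fsuc i)))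
  ... | ()
  ¬lo-even i (fsuc j) eq = even≢odd (fsuc i) j (sym (trans (sym (lo-suc j)) eq))

  hi-even : ∀ i j → hi j ≡ even (fsuc i) → j ≡ inject₁ i
  hi-even i j eq with view j
  ... | ‵fromℕ      = contradiction (subst Far eq hi-top-far) (even-near (fsuc i))
  ... | ‵inject₁ i' = cong inject₁ (Fin.suc-injective (even-injective (trans (sym (hi-inject₁ i')) eq)))

  lo-odd : ∀ i j → lo j ≡ odd i → j ≡ fsuc i
  lo-odd i fzero    eq = contradiction (trans (sym lo-zero) eq) (even≢odd fzero i)
  lo-odd i (fsuc j) eq = cong fsuc (odd-injective (trans (sym (lo-suc j)) eq))

  ¬hi-odd : ∀ i j → hi j ≢ odd i
  ¬hi-odd i j eq with view j
  ... | ‵fromℕ      = odd-near i (subst Far eq hi-top-far)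
  ... | ‵inject₁ i' = even≢odd (fsuc i') i (trans (sym (hi-inject₁ i')) eq)

  incident-even : ∀ i e → Incident ladder e (even (fsuc i)) →
                  e ≡ cyc (odd i) ⊎ e ≡ cyc (even (fsuc i)) ⊎ e ≡ chord (inject₁ i)
  incident-even i e inc with incident-cases (odd i) e (subst (Incident ladder e) (sym (succ-odd i)) inc)
  ... | inj₁ (inj₁ eq)          = inj₁ eq
  ... | inj₁ (inj₂ eq)          = inj₂ (inj₁ (trans eq (cong cyc (succ-odd i))))
  ... | inj₂ (j , _  , inj₁ at) = contradiction (trans at (succ-odd i)) (¬lo-even i j)
  ... | inj₂ (j , eq , inj₂ at) = inj₂ (inj₂ (trans eq (cong chord (hi-even i j (trans at (succ-odd i))))))

  incident-odd : ∀ i e → Incident ladder e (odd i) →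
                 e ≡ cyc (even (inject₁ i)) ⊎ e ≡ cyc (odd i) ⊎ e ≡ chord (fsuc i)
  incident-odd i e inc with incident-cases (even (inject₁ i)) e (subst (Incident ladder e) (sym (succ-even i)) inc)
  ... | inj₁ (inj₁ eq)          = inj₁ eq
  ... | inj₁ (inj₂ eq)          = inj₂ (inj₁ (trans eq (cong cyc (succ-even i))))
  ... | inj₂ (j , eq , inj₁ at) = inj₂ (inj₂ (trans eq (cong chord (lo-odd i j (trans at (succ-even i))))))
  ... | inj₂ (j , _  , inj₂ at) = contradiction (trans at (succ-even i)) (¬hi-odd i j)

  incident-far : ∀ u e → suc (double K) < toℕ (succMod u) → Incident ladder e (succMod u) →
                 e ≡ cyc u ⊎ e ≡ cyc (succMod u)
  incident-far u e beyond inc with incident-cases u e inc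
  ... | inj₁ eqs               = eqs
  ... | inj₂ (j , _ , inj₁ at) = contradiction (ℕ.<-≤-trans beyond
          (ℕ.≤-trans (ℕ.≤-reflexive (cong toℕ (sym at))) (ℕ.≤-trans (ℕ.<⇒≤ (lo<hi j)) (hi≤ j)))) ℕ.1+n≰n
  ... | inj₂ (j , _ , inj₂ at) = contradiction (ℕ.<-≤-trans beyond
          (ℕ.≤-trans (ℕ.≤-reflexive (cong toℕ (sym at))) (hi≤ j))) ℕ.1+n≰n

  last : Fin n
  last = proj₁ (injective⇒surjective succMod-injective (even fzero))

  succ-last : succMod last ≡ even fzero
  succ-last = proj₂ (injective⇒surjective succMod-injective (even fzero))

  incident-zero : ∀ e → Incident ladder e (even fzero) →
                  e ≡ cyc last ⊎ e ≡ cyc (even fzero) ⊎ e ≡ chord fzero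
  incident-zero e inc with incident-cases last e (subst (Incident ladder e) (sym succ-last) inc)
  ... | inj₁ (inj₁ eq)          = inj₁ eq
  ... | inj₁ (inj₂ eq)          = inj₂ (inj₁ (trans eq (cong cyc succ-last)))
  ... | inj₂ (j , eq , inj₁ at) = inj₂ (inj₂ (trans eq (cong chord (lo-injective (trans at (trans succ-last (sym lo-zero)))))))
  ... | inj₂ (j , _  , inj₂ at) = contradiction (subst (toℕ (lo j) <_)
          (trans (cong toℕ (trans at succ-last)) (toℕ-even fzero)) (lo<hi j)) ℕ.n≮0

  module _ {S} (hc : IsHC ladder S) where

    -- The inner vertices of the return path have degree two, so all its edges are forced.
    far∈S : ∀ u → Far u → cyc u ∈ S
    far∈S u f with succMod-cases u
    ... | inj₁ (_ , p) = proj₁ (HC-forced ladder hc (succMod u) λ e _ →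
            incident-far u e (ℕ.≤-trans (s≤s f) (ℕ.≤-reflexive (sym p))))
    -- The closing edge is forced at its start `n - 1`, which by `room` is an inner vertex of the
    -- return path; its other end 0 has degree three.
    ... | inj₂ (p , _) with v , refl ← injective⇒surjective succMod-injective u =
            proj₂ (HC-forced ladder hc (succMod v) λ e _ →
              incident-far v e (ℕ.≤-pred (ℕ.≤-trans room (ℕ.≤-reflexive (sym p)))))

    last-far : Far last
    last-far with succMod-cases last
    ... | inj₁ (_ , p) with trans (sym p) (trans (cong toℕ succ-last) (toℕ-even fzero))
    ...   | ()
    last-far | inj₂ (p , _) = ℕ.≤-pred (ℕ.≤-trans (ℕ.≤-trans (ℕ.n≤1+n _) room) (ℕ.≤-reflexive (sym p)))

    data Rung (a b : Fin (n + suc K)) : Set where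
      straight : a ∈ S → b ∉ S → Rung a b
      crossed  : a ∉ S → b ∈ S → Rung a b

    -- The closing edge is forced at vertex 0, so exactly one of the two other edges there is used.
    -- This one choice determines the whole cycle.
    start : Rung (cyc (even fzero)) (chord fzero)
    start with cyc (even fzero) ∈? S
    ... | yes a∈ = straight a∈ (HC-excluded ladder hc (even fzero)
            (λ eq → even-near fzero (subst Far (cyc-injective eq) last-far))
            (cyc≢chord _ _) (cyc≢chord _ _)
            (subst (Incident ladder _) succ-last (Joins⇒Incidentʳ ladder (cyc-joins last)))
            (Joins⇒Incidentˡ ladder (cyc-joins _))
            (subst (Incident ladder _) lo-zero (Joins⇒Incidentˡ ladder (chord-joins fzero)))
            (far∈S last last-far) a∈)
    ... | no a∉ = crossed a∉ (proj₂ (HC-forced ladder hc (even fzero) {cyc last} only))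
      where
      only : ∀ e → e ∈ S → Incident ladder e (even fzero) → e ≡ cyc last ⊎ e ≡ chord fzero
      only e e∈ inc with incident-zero e inc
      ... | inj₁ eq          = inj₁ eq
      ... | inj₂ (inj₁ refl) = contradiction e∈ a∉
      ... | inj₂ (inj₂ eq)   = inj₂ eq

    a≢m : ∀ i → cyc (even (inject₁ i)) ≢ cyc (odd i)
    a≢m i = even≢odd (inject₁ i) i ∘ cyc-injective

    -- Without chord `i`, vertex `2i + 2` must use the rung and its next cycle edge. The rung and
    -- the cycle edge from `2i` then saturate `2i + 1`, which rules out chord `i + 1`.
    straight-step : ∀ i → cyc (even (inject₁ i)) ∈ S → chord (inject₁ i) ∉ S →
                    cyc (odd i) ∈ S × cyc (even (fsuc i)) ∈ S × chord (fsuc i) ∉ S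
    straight-step i a∈ b∉ = proj₁ forced , proj₂ forced ,
      HC-excluded ladder hc (odd i) (a≢m i) (cyc≢chord _ _) (cyc≢chord _ _)
        (subst (Incident ladder _) (succ-even i) (Joins⇒Incidentʳ ladder (cyc-joins _)))
        (Joins⇒Incidentˡ ladder (cyc-joins _))
        (subst (Incident ladder _) (lo-suc i) (Joins⇒Incidentˡ ladder (chord-joins _)))
        a∈ (proj₁ forced)
      where
      only : ∀ e → e ∈ S → Incident ladder e (even (fsuc i)) → e ≡ cyc (odd i) ⊎ e ≡ cyc (even (fsuc i))
      only e e∈ inc with incident-even i e inc
      ... | inj₁ eq          = inj₁ eq
      ... | inj₂ (inj₁ eq)   = inj₂ eq
      ... | inj₂ (inj₂ refl) = contradiction e∈ b∉
      forced = HC-forced ladder hc (even (fsuc i)) only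

    -- The mirror image of `straight-step`: now `2i + 1` forces the rung and chord `i + 1`, and
    -- `2i + 2` is saturated by the rung and chord `i`.
    crossed-step : ∀ i → cyc (even (inject₁ i)) ∉ S → chord (inject₁ i) ∈ S →
                   cyc (odd i) ∈ S × cyc (even (fsuc i)) ∉ S × chord (fsuc i) ∈ S
    crossed-step i a∉ b∈ = proj₁ forced ,
      HC-excluded ladder hc (even (fsuc i)) (cyc≢chord _ _ ∘ sym)
        (cyc≢chord _ _ ∘ sym) (λ eq → even≢odd (fsuc i) i (sym (cyc-injective eq)))
        (subst (Incident ladder _) (hi-inject₁ i) (Joins⇒Incidentʳ ladder (chord-joins _)))
        (subst (Incident ladder _) (succ-odd i) (Joins⇒Incidentʳ ladder (cyc-joins _)))
        (Joins⇒Incidentˡ ladder (cyc-joins _))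
        b∈ (proj₁ forced) ,
      proj₂ forced
      where
      only : ∀ e → e ∈ S → Incident ladder e (odd i) → e ≡ cyc (odd i) ⊎ e ≡ chord (fsuc i)
      only e e∈ inc with incident-odd i e inc
      ... | inj₁ refl      = contradiction e∈ a∉
      ... | inj₂ (inj₁ eq) = inj₁ eq
      ... | inj₂ (inj₂ eq) = inj₂ eq
      forced = HC-forced ladder hc (odd i) only

    ∉⇒false : ∀ {e} → e ∉ S → lookup S e ≡ false
    ∉⇒false {e} e∉ with lookup S e in eq
    ... | true  = contradiction (lookup⇒[]= e S eq) e∉
    ... | false = refl

    straight-all : cyc (even fzero) ∈ S → chord fzero ∉ S → S ≡ hcA
    straight-all a∈ b∉ = ≡select S (λ u → []=⇒lookup (on-cyc u)) (λ j → ∉⇒false (proj₂ (at j)))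
      where
      at : ∀ j → cyc (even j) ∈ S × chord j ∉ S
      at = <-weakInduction _ (a∈ , b∉) λ i (p , q) → proj₂ (straight-step i p q)
      on-cyc : ∀ u → cyc u ∈ S
      on-cyc u with position u
      ... | at-even j refl = proj₁ (at j)
      ... | at-odd i refl  = proj₁ (straight-step i (proj₁ (at (inject₁ i))) (proj₂ (at (inject₁ i))))
      ... | far f          = far∈S u f

    crossed-all : cyc (even fzero) ∉ S → chord fzero ∈ S → S ≡ hcB
    crossed-all a∉ b∈ = ≡select S on-cyc (λ j → []=⇒lookup (proj₂ (at j)))
      where
      at : ∀ j → cyc (even j) ∉ S × chord j ∈ S
      at = <-weakInduction _ (a∉ , b∈) λ i (p , q) → proj₂ (crossed-step i p q)
      on-cyc : ∀ u → lookup S (cyc u) ≡ offEven u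
      on-cyc u with position u
      ... | at-even j refl = ∉⇒false (proj₁ (at j))
      ... | at-odd i refl  = []=⇒lookup (proj₁ (crossed-step i (proj₁ (at (inject₁ i))) (proj₂ (at (inject₁ i)))))
      ... | far f          = []=⇒lookup (far∈S u f)

    HC⇒A⊎B : S ≡ hcA ⊎ S ≡ hcB
    HC⇒A⊎B with start
    ... | straight a∈ b∉ = inj₁ (straight-all a∈ b∉)
    ... | crossed a∉ b∈  = inj₂ (crossed-all a∉ b∈)

  -- Balanced weights on the ladder

  hcA≢hcB : hcA ≢ hcB
  hcA≢hcB eq with trans (sym (lookup-chord _ _ fzero)) (trans (cong (λ S → lookup S (chord fzero)) eq) (lookup-chord _ _ fzero))
  ... | ()

  weight-hcA≡hcB : ∀ ω → sum (ω ∘ cyc ∘ even) ≡ sum (ω ∘ chord) → weight ω hcA ≡ weight ω hcB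
  weight-hcA≡hcB ω balanced = begin
    weight ω hcA                                                      ≡⟨ split hcA ⟩
    sum (restrict hcA ω ∘ cyc) + sum (restrict hcA ω ∘ chord)         ≡⟨ cong₂ _+_ (sum-cong-≗ cycA) (sum-zero chordA) ⟩
    sum (ω ∘ cyc) + 0                                                 ≡⟨ ℕ.+-identityʳ _ ⟩
    sum (ω ∘ cyc)                                                     ≡⟨ sum-cong-≗ parts ⟩
    sum (λ u → off u + on u)                                          ≡⟨ ∑-distrib-+ off on ⟩
    sum off + sum on                                                  ≡⟨ cong (sum off +_) (trans (sum-image even even-injective (ω ∘ cyc) on on-even on-other) balanced) ⟩
    sum off + sum (ω ∘ chord)                                         ≡⟨ cong₂ _+_ (sum-cong-≗ cycB) (sum-cong-≗ chordB) ⟨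
    sum (restrict hcB ω ∘ cyc) + sum (restrict hcB ω ∘ chord)         ≡⟨ split hcB ⟨
    weight ω hcB                                                      ∎
    where
    open ≡-Reasoning
    -- `off` collects the cycle edges that both Hamiltonian cycles use, `on` those that only `hcA`
    -- uses.
    off on : Fin n → ℕ
    off u = if offEven u then ω (cyc u) else 0
    on u  = if offEven u then 0 else ω (cyc u)
    split : ∀ S → weight ω S ≡ sum (restrict S ω ∘ cyc) + sum (restrict S ω ∘ chord)
    split S = trans (weight≡sum ω S) (sum-↑ n (restrict S ω))
    cycA : ∀ u → restrict hcA ω (cyc u) ≡ ω (cyc u)
    cycA u = cong (if_then ω (cyc u) else 0) (lookup-cyc _ _ u)
    cycB : ∀ u → restrict hcB ω (cyc u) ≡ off u
    cycB u = cong (if_then ω (cyc u) else 0) (lookup-cyc _ _ u)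
    chordA : ∀ j → restrict hcA ω (chord j) ≡ 0
    chordA j = cong (if_then ω (chord j) else 0) (lookup-chord _ _ j)
    chordB : ∀ j → restrict hcB ω (chord j) ≡ ω (chord j)
    chordB j = cong (if_then ω (chord j) else 0) (lookup-chord _ _ j)
    parts : ∀ u → ω (cyc u) ≡ off u + on u
    parts u with offEven u
    ... | true  = sym (ℕ.+-identityʳ _)
    ... | false = refl
    on-even : ∀ j → on (even j) ≡ ω (cyc (even j))
    on-even j = cong (if_then 0 else ω (cyc (even j))) (OffEven.cases-even j)
    on-other : ∀ u → (∀ j → even j ≢ u) → on u ≡ 0
    on-other u not-even with position u
    ... | at-even j eq  = contradiction eq (not-even j)
    ... | at-odd _ _    = refl
    ... | far _         = refl

  ladder-not-isolated : ∀ ω → sum (ω ∘ cyc ∘ even) ≡ sum (ω ∘ chord) → ¬ Isolates ω (IsHC ladder)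
  ladder-not-isolated ω balanced (S , hc , lightest) with HC⇒A⊎B hc
  ... | inj₁ refl = ℕ.<⇒≢ (lightest hcB hcB-isHC (hcA≢hcB ∘ sym)) (weight-hcA≡hcB ω balanced)
  ... | inj₂ refl = ℕ.<⇒≢ (lightest hcA hcA-isHC hcA≢hcB) (sym (weight-hcA≡hcB ω balanced))

-- Relabelling edges

⟨$⟩ʳ-injective : ∀ {m} (π : Permutation′ m) → Injective _≡_ _≡_ (π ⟨$⟩ʳ_)
⟨$⟩ʳ-injective π = Injection.injective (↔⇒↣ π)

relabel : ∀ {n m} → Permutation′ m → Graph n m → Graph n m
relabel π G = record
  { ends     = λ e → ends G (π ⟨$⟩ʳ e)
  ; loopless = λ e → loopless G (π ⟨$⟩ʳ e)
  ; simple   = λ e f same → ⟨$⟩ʳ-injective π (simple G _ _ same)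
  }

relabel-treewidth : ∀ {n m w} (π : Permutation′ m) (G : Graph n m) →
                    TreewidthAtMost G w → TreewidthAtMost (relabel π G) w
relabel-treewidth π G td = record
  { TreeDecomposition td hiding (cover-edge)
  ; cover-edge = λ e → TreeDecomposition.cover-edge td (π ⟨$⟩ʳ e)
  }

-- The preimage of `S` under `π`, in accordance with `relabel`, where label `e` sits on the edge
-- `π ⟨$⟩ʳ e` of `G`.
pull : ∀ {m} → Permutation′ m → Subset m → Subset m
pull π S = tabulate (λ e → lookup S (π ⟨$⟩ʳ e))

∈pull : ∀ {m} (π : Permutation′ m) {S e} → π ⟨$⟩ʳ e ∈ S → e ∈ pull π S
∈pull π {S} {e} e∈ = lookup⇒[]= e (pull π S) (trans (lookup∘tabulate _ e) ([]=⇒lookup e∈))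

pull∋ : ∀ {m} (π : Permutation′ m) {S e} → e ∈ pull π S → π ⟨$⟩ʳ e ∈ S
pull∋ π {S} {e} e∈ = lookup⇒[]= (π ⟨$⟩ʳ e) S
  (trans (sym (lookup∘tabulate (λ e → lookup S (π ⟨$⟩ʳ e)) e)) ([]=⇒lookup e∈))

pull-flip : ∀ {m} (π : Permutation′ m) S → pull (flip π) (pull π S) ≡ S
pull-flip π S = trans (tabulate-cong λ e → trans (lookup∘tabulate (λ e → lookup S (π ⟨$⟩ʳ e)) (π ⟨$⟩ˡ e)) (cong (lookup S) (inverseʳ π))) (tabulate∘lookup S)

-- The two graphs are related by an equation between their ends so that the lemma also applies
-- backwards, with `flip π`, where the ends agree only up to `inverseʳ`.
pull-isHC : ∀ {n m} {G H : Graph n m} (π : Permutation′ m) →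
            (∀ e → ends H e ≡ ends G (π ⟨$⟩ʳ e)) → ∀ {S} → IsHC G S → IsHC H (pull π S)
pull-isHC {G = G} {H} π ends≡ {S} (3≤n , σ , σ-inj , edge , S⇔) =
  3≤n , σ , σ-inj , (λ i → let e , J = edge i in π ⟨$⟩ˡ e , toH (subst (λ e → Joins G e _ _) (sym (inverseʳ π)) J)) ,
  λ e → record
    { to        = λ e∈ → let i , J = Equivalence.to (S⇔ _) (pull∋ π e∈) in i , toH J
    ; from      = λ (i , J) → ∈pull π (Equivalence.from (S⇔ _) (i , subst (λ p → SameEnds p _) (ends≡ e) J))
    ; to-cong   = λ { refl → refl }
    ; from-cong = λ { refl → refl }
    }
  where
  toH : ∀ {e u v} → Joins G (π ⟨$⟩ʳ e) u v → Joins H e u v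
  toH {e} = subst (λ p → SameEnds p _) (sym (ends≡ e))

weight-pull : ∀ {m} (π : Permutation′ m) {ω ω' : Fin m → ℕ} → (∀ e → ω e ≡ ω' (π ⟨$⟩ʳ e)) →
              ∀ S → weight ω (pull π S) ≡ weight ω' S
weight-pull π {ω} {ω'} ω≡ S = begin
  weight ω (pull π S)                     ≡⟨ weight≡sum ω (pull π S) ⟩
  sum (restrict (pull π S) ω)             ≡⟨ sum-cong-≗ (λ e → cong₂ (λ b w → if b then w else 0) (lookup∘tabulate _ e) (ω≡ e)) ⟩
  sum (restrict S ω' ∘ (π ⟨$⟩ʳ_))         ≡⟨ sum-permute (restrict S ω') π ⟨
  sum (restrict S ω')                     ≡⟨ weight≡sum ω' S ⟨
  weight ω' S                             ∎
  where
  open ≡-Reasoning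

-- Pulling back along `π` is a weight-preserving bijection between the Hamiltonian cycles of the two
-- graphs, with inverse `pull (flip π)`.
relabel-isolates : ∀ {n m} (π : Permutation′ m) (G : Graph n m) (ω : Fin m → ℕ) →
                   Isolates ω (IsHC (relabel π G)) → Isolates (λ e → ω (π ⟨$⟩ˡ e)) (IsHC G)
relabel-isolates π G ω (S , hc , lightest) = pull (flip π) S ,
  pull-isHC {G = relabel π G} {G} (flip π) (λ _ → cong (ends G) (sym (inverseʳ π))) hc ,
  λ T hcT T≢ → subst₂ _<_ (sym (weight-pull (flip π) (λ _ → refl) S)) (weight-pull π (λ _ → cong ω (sym (inverseˡ π))) T)
    (lightest (pull π T) (pull-isHC {G = G} {relabel π G} π (λ _ → refl) hcT)
      λ eq → T≢ (trans (sym (pull-flip π T)) (cong (pull (flip π)) eq)))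

transpose-source : ∀ {n} (i j : Fin n) → Components.transpose i j i ≡ j
transpose-source i j rewrite dec-true (i Fin.≟ i) refl = refl

transpose-other : ∀ {n} (i j k : Fin n) → k ≢ i → k ≢ j → Components.transpose i j k ≡ k
transpose-other i j k k≢i k≢j
  rewrite dec-false (k Fin.≟ i) k≢i | dec-false (k Fin.≟ j) k≢j = refl

-- Once `π` is correct on the tail, a transposition moves the image of `f fzero` to `g fzero`. By
-- injectivity neither of these points is some `g (fsuc i)`, so the tail is not disturbed.
permutation-extending : ∀ {a m} (f g : Fin a → Fin m) → Injective _≡_ _≡_ f → Injective _≡_ _≡_ g →
                        Σ (Permutation′ m) λ π → ∀ i → π ⟨$⟩ʳ f i ≡ g i
permutation-extending {zero}  f g f-inj g-inj = idₚ , λ ()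
permutation-extending {suc a} f g f-inj g-inj
  with π , π-ext ← permutation-extending (f ∘ fsuc) (g ∘ fsuc) (Fin.suc-injective ∘ f-inj) (Fin.suc-injective ∘ g-inj)
  = π ∘ₚ transpose (π ⟨$⟩ʳ f fzero) (g fzero) , λ where
      fzero    → transpose-source (π ⟨$⟩ʳ f fzero) (g fzero)
      (fsuc i) → trans
        (transpose-other _ _ _
          (λ eq → contradiction (f-inj (⟨$⟩ʳ-injective π eq)) λ ())
          (λ eq → contradiction (g-inj (trans (sym (π-ext i)) eq)) λ ()))
        (π-ext i)

glue-injective : ∀ {a b} {X : Set} {f : Fin a → X} {g : Fin b → X} →
                 Injective _≡_ _≡_ f → Injective _≡_ _≡_ g → (∀ i j → f i ≢ g j) →
                 Injective _≡_ _≡_ ([ f , g ]′ ∘ splitAt a)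
glue-injective {a} {b} {f = f} {g} f-inj g-inj disjoint {x} {y} eq =
  trans (sym (Fin.join-splitAt a b x)) (trans (cong (join a b) (on-sum (splitAt a x) (splitAt a y) eq)) (Fin.join-splitAt a b y))
  where
  on-sum : ∀ s t → [ f , g ]′ s ≡ [ f , g ]′ t → s ≡ t
  on-sum (inj₁ i) (inj₁ j) eq = cong inj₁ (f-inj eq)
  on-sum (inj₁ i) (inj₂ j) eq = contradiction eq (disjoint i j)
  on-sum (inj₂ i) (inj₁ j) eq = contradiction (sym eq) (disjoint j i)
  on-sum (inj₂ i) (inj₂ j) eq = cong inj₂ (g-inj eq)

Balanced : ∀ {m ℓ} → (Fin ℓ → Fin m → ℕ) → ℕ → Set
Balanced {m} ω d = ∃₂ λ (α β : Fin d → Fin m) →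
  Injective _≡_ _≡_ α × Injective _≡_ _≡_ β × (∀ i j → α i ≢ β j) ×
  (∀ l → sum (ω l ∘ α) ≡ sum (ω l ∘ β))

-- Existence of a Hamiltonian cycle is part of the notion because `good` makes its promise for
-- Hamiltonian graphs only.
Unisolated : ∀ {m ℓ} → (Fin ℓ → Fin m → ℕ) → Set
Unisolated {m} ω = ∃[ n ] Σ (Graph n m) λ G →
  TreewidthAtMost G 4 × (∃[ S ] IsHC G S) × (∀ l → ¬ Isolates (ω l) (IsHC G))

-- The permutation puts the labels `α` on the edges `cyc (even j)` and the labels `β` on the chords.
-- Seen from the ladder, `ω l` becomes `ω l` after the inverse of `π`, for which the two cycles
-- weigh the same.
balanced⇒unisolated : ∀ {K n m ℓ} → 1 ≤ K → 3 + double K ≤ n → n + suc K ≡ m →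
  (ω : Fin ℓ → Fin m → ℕ) → Balanced ω (suc K) → Unisolated ω
balanced⇒unisolated {K} {n} 1≤K room refl ω (α , β , α-inj , β-inj , disjoint , balanced) =
  n , relabel π ladder , relabel-treewidth π ladder ladder-treewidth ,
  (_ , pull-isHC {G = ladder} {relabel π ladder} π (λ _ → refl) hcA-isHC) ,
  λ l iso → ladder-not-isolated (λ e → ω l (π ⟨$⟩ˡ e))
    (trans (sum-cong-≗ (λ j → cong (ω l) (backA j)))
      (trans (balanced l) (sym (sum-cong-≗ (λ j → cong (ω l) (backB j))))))
    (relabel-isolates π ladder (ω l) iso)
  where
  open Ladder K n 1≤K room
  labels positions : Fin (suc K + suc K) → Fin (n + suc K)
  labels    = [ α , β ]′ ∘ splitAt (suc K)
  positions = [ cyc ∘ even , chord ]′ ∘ splitAt (suc K)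
  extension = permutation-extending labels positions (glue-injective α-inj β-inj disjoint)
    (glue-injective (even-injective ∘ cyc-injective) chord-injective (λ i j → cyc≢chord (even i) j))
  π = proj₁ extension
  back : ∀ i → π ⟨$⟩ˡ positions i ≡ labels i
  back i = trans (cong (π ⟨$⟩ˡ_) (sym (proj₂ extension i))) (inverseˡ π)
  backA : ∀ j → π ⟨$⟩ˡ cyc (even j) ≡ α j
  backA j = subst (λ s → π ⟨$⟩ˡ [ cyc ∘ even , chord ]′ s ≡ [ α , β ]′ s) (Fin.splitAt-↑ˡ (suc K) j (suc K)) (back (j ↑ˡ suc K))
  backB : ∀ j → π ⟨$⟩ˡ chord j ≡ β j
  backB j = subst (λ s → π ⟨$⟩ˡ [ cyc ∘ even , chord ]′ s ≡ [ α , β ]′ s) (Fin.splitAt-↑ʳ (suc K) (suc K) j) (back (suc K ↑ʳ j))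

-- Two selections of equal weight

funToFin-cong : ∀ {m n} {f g : Fin m → Fin n} → f ≗ g → funToFin f ≡ funToFin g
funToFin-cong {zero}  f≗g = refl
funToFin-cong {suc m} f≗g = cong₂ combine (f≗g fzero) (funToFin-cong (f≗g ∘ fsuc))

-- Each of the `2 ^ k` choices has a vector of `L` totals between 0 and `k * W`. Choices and vectors
-- are coded as numbers by `funToFin` and `finToFun` so that the pigeonhole principle for `Fin`
-- applies.
equal-sums : ∀ {L k W} (g : Fin L → Fin k → Fin 2 → ℕ) → (∀ l i b → g l i b ≤ W) →
             suc (k * W) ^ L < 2 ^ k →
             ∃₂ λ (x y : Fin k → Fin 2) → (∃[ i ] x i ≢ y i) ×
               (∀ l → sum (λ i → g l i (x i)) ≡ sum (λ i → g l i (y i)))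
equal-sums {L} {k} {W} g g≤W few = x , y , Fin.¬∀⟶∃¬ k _ (λ i → x i Fin.≟ y i) distinct , same
  where
  total : (Fin k → Fin 2) → Fin L → ℕ
  total x l = sum (λ i → g l i (x i))
  total< : ∀ x l → total x l < suc (k * W)
  total< x l = s≤s (sum-≤ _ (λ i → g≤W l i (x i)))
  totals : (Fin k → Fin 2) → Fin L → Fin (suc (k * W))
  totals x l = fromℕ< (total< x l)
  collision = Fin.pigeonhole few (λ c → funToFin (totals (finToFun c)))
  c  = proj₁ collision
  c' = proj₁ (proj₂ collision)
  x y : Fin k → Fin 2
  x = finToFun c
  y = finToFun c'
  distinct : ¬ (∀ i → x i ≡ y i)
  distinct x≗y = Fin.<⇒≢ (proj₁ (proj₂ (proj₂ collision)))
    (trans (sym (Fin.funToFin-finToFin {k} {2} c)) (trans (funToFin-cong x≗y) (Fin.funToFin-finToFin {k} {2} c')))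
  same : ∀ l → total x l ≡ total y l
  same l = begin
    total x l                                 ≡⟨ Fin.toℕ-fromℕ< (total< x l) ⟨
    toℕ (totals x l)                          ≡⟨ cong toℕ (Fin.finToFun-funToFin (totals x) l) ⟨
    toℕ (finToFun (funToFin (totals x)) l)    ≡⟨ cong (λ c → toℕ (finToFun {suc (k * W)} {L} c l)) (proj₂ (proj₂ (proj₂ collision))) ⟩
    toℕ (finToFun (funToFin (totals y)) l)    ≡⟨ cong toℕ (Fin.finToFun-funToFin (totals y) l) ⟩
    toℕ (totals y l)                          ≡⟨ Fin.toℕ-fromℕ< (total< y l) ⟩
    total y l                                 ∎
    where open ≡-Reasoning

enumerate : ∀ {k} {P : Fin k → Set} → (∀ i → Dec (P i)) →
            Σ ℕ λ d → Σ (Fin d → Fin k) λ u →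
              Injective _≡_ _≡_ u × (∀ j → P (u j)) × (∀ i → P i → ∃[ j ] u j ≡ i)
enumerate {zero}  P? = 0 , (λ ()) , (λ { {()} }) , (λ ()) , λ ()
enumerate {suc k} {P} P? with enumerate (P? ∘ fsuc) | P? fzero
... | d , u , u-inj , u-in , u-all | no ¬p = d , fsuc ∘ u , u-inj ∘ Fin.suc-injective , u-in , λ where
        fzero    p → contradiction p ¬p
        (fsuc i) p → let j , eq = u-all i p in j , cong fsuc eq
... | d , u , u-inj , u-in , u-all | yes p = suc d , u' , u'-inj , u'-in , u'-all
  where
  u' : Fin (suc d) → Fin (suc k)
  u' fzero    = fzero
  u' (fsuc j) = fsuc (u j)
  u'-inj : Injective _≡_ _≡_ u'
  u'-inj {fzero}  {fzero}  _  = refl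
  u'-inj {fsuc i} {fsuc j} eq = cong fsuc (u-inj (Fin.suc-injective eq))
  u'-in : ∀ j → P (u' j)
  u'-in fzero    = p
  u'-in (fsuc j) = u-in j
  u'-all : ∀ i → P i → ∃[ j ] u' j ≡ i
  u'-all fzero    _ = fzero , refl
  u'-all (fsuc i) q = let j , eq = u-all i q in fsuc j , cong fsuc eq

-- Off the image of `u` the two sums have the same terms, which cancel.
sum-image-cancel : ∀ {d k} (u : Fin d → Fin k) → Injective _≡_ _≡_ u → (f g : Fin k → ℕ) →
                   (∀ i → (∀ j → u j ≢ i) → f i ≡ g i) → sum f ≡ sum g → sum (f ∘ u) ≡ sum (g ∘ u)
sum-image-cancel {k = k} u u-inj f g agree eq = ℕ.+-cancelʳ-≡ (sum (off f)) _ _ (begin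
  sum (f ∘ u) + sum (off f)   ≡⟨ split f ⟨
  sum f                       ≡⟨ eq ⟩
  sum g                       ≡⟨ split g ⟩
  sum (g ∘ u) + sum (off g)   ≡⟨ cong (sum (g ∘ u) +_) (sum-cong-≗ off≗) ⟨
  sum (g ∘ u) + sum (off f)   ∎)
  where
  open ≡-Reasoning
  hit? : ∀ i → Dec (∃[ j ] u j ≡ i)
  hit? i = Fin.any? (λ j → u j Fin.≟ i)
  on off : (Fin k → ℕ) → Fin k → ℕ
  on  h i = if does (hit? i) then h i else 0
  off h i = if does (hit? i) then 0 else h i
  off≗ : ∀ i → off f i ≡ off g i
  off≗ i with hit? i
  ... | yes _ = refl
  ... | no ∄j = agree i (λ j eq → ∄j (j , eq))
  parts : ∀ h i → h i ≡ on h i + off h i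
  parts h i with hit? i
  ... | yes _ = sym (ℕ.+-identityʳ _)
  ... | no _  = refl
  split : ∀ h → sum h ≡ sum (h ∘ u) + sum (off h)
  split h = trans (sum-cong-≗ (parts h)) (trans (∑-distrib-+ (on h) (off h)) (cong (_+ sum (off h))
    (sum-image u u-inj h (on h)
      (λ j → cong (if_then h (u j) else 0) (dec-true (hit? (u j)) (j , refl)))
      (λ i not-hit → cong (if_then h i else 0) (dec-false (hit? i) λ (j , eq) → not-hit j eq)))))

equal-sums-on-differences : ∀ {L k W} (g : Fin L → Fin k → Fin 2 → ℕ) → (∀ l i b → g l i b ≤ W) →
  suc (k * W) ^ L < 2 ^ k →
  ∃[ d ] (1 ≤ d × ∃[ u ] (Injective _≡_ _≡_ u × ∃₂ λ (x y : Fin d → Fin 2) → (∀ j → x j ≢ y j) ×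
    (∀ l → sum (λ j → g l (u j) (x j)) ≡ sum (λ j → g l (u j) (y j)))))
equal-sums-on-differences g g≤W few
  with x , y , (i₀ , x≢y) , same ← equal-sums g g≤W few
  with d , u , u-inj , u-in , u-all ← enumerate (λ i → ¬? (x i Fin.≟ y i))
  = d , ℕ.≤-trans (s≤s z≤n) (Fin.toℕ<n (proj₁ (u-all i₀ x≢y))) , u , u-inj , x ∘ u , y ∘ u , u-in , λ l →
    sum-image-cancel u u-inj _ _ (λ i missed → cong (g l i) (agree i missed)) (same l)
  where
  agree : ∀ i → (∀ j → u j ≢ i) → x i ≡ y i
  agree i missed with x i Fin.≟ y i
  ... | yes eq = eq
  ... | no  ne = contradiction (proj₂ (u-all i ne)) (missed _)

-- The pairs are the labels `2i` and `2i + 1`. Where the two choices differ they take opposite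
-- members of a pair, so the families read off there are disjoint.
balanced-families : ∀ {m ℓ k W} (ω : Fin ℓ → Fin m → ℕ) → (∀ l e → ω l e ≤ W) → 1 ≤ W →
  k * 2 ≤ m → suc (k * W) ^ suc ℓ < 2 ^ k →
  ∃[ K ] (1 ≤ K × suc K ≤ k × Balanced ω (suc K))
balanced-families {m} {ℓ} {k} {W} ω ω≤W 1≤W 2k≤m few = families (equal-sums-on-differences g g≤W few)
  where
  label : Fin k → Fin 2 → Fin m
  label i b = inject≤ (combine i b) 2k≤m
  label-injective : ∀ {i i' b b'} → label i b ≡ label i' b' → i ≡ i' × b ≡ b'
  label-injective {i} {i'} {b} {b'} eq = Fin.combine-injective i b i' b' (Fin.inject≤-injective 2k≤m 2k≤m _ _ eq)
  -- The extra weight function g 0 counts the choices of 1, which rules out a single difference.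
  g : Fin (suc ℓ) → Fin k → Fin 2 → ℕ
  g fzero    i b = toℕ b
  g (fsuc l) i b = ω l (label i b)
  g≤W : ∀ l i b → g l i b ≤ W
  g≤W fzero    i b = ℕ.≤-trans (ℕ.≤-pred (Fin.toℕ<n b)) 1≤W
  g≤W (fsuc l) i b = ω≤W l _
  families : ∃[ d ] (1 ≤ d × ∃[ u ] (Injective _≡_ _≡_ u × ∃₂ λ (x y : Fin d → Fin 2) → (∀ j → x j ≢ y j) ×
    (∀ l → sum (λ j → g l (u j) (x j)) ≡ sum (λ j → g l (u j) (y j))))) →
    ∃[ K ] (1 ≤ K × suc K ≤ k × Balanced ω (suc K))
  families (1 , _ , u , _ , x , y , x≢y , same) =
    contradiction (Fin.toℕ-injective (ℕ.+-cancelʳ-≡ 0 _ _ (same fzero))) (x≢y fzero)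
  families (suc (suc K) , _ , u , u-inj , x , y , x≢y , same) =
    suc K , s≤s z≤n , Fin.injective⇒≤ u-inj , (λ j → label (u j) (x j)) , (λ j → label (u j) (y j)) ,
    (λ eq → u-inj (proj₁ (label-injective eq))) , (λ eq → u-inj (proj₁ (label-injective eq))) , disjoint , same ∘ fsuc
    where
    disjoint : ∀ i j → label (u i) (x i) ≢ label (u j) (y j)
    disjoint i j eq with label-injective eq
    ... | u≡ , x≡y with refl ← u-inj u≡ = x≢y i x≡y

-- A ladder with `K + 1` chords has at least `2K + 3` vertices, hence `3K + 4` edges at the least.
-- Four edges per chord are enough, which is the origin of `k * 4 ≤ m`.
room-bound : ∀ K → 3 + double K + suc K ≤ suc K * 4
room-bound zero    = ℕ.≤-refl
room-bound (suc K) = ℕ.≤-trans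
  (s≤s (s≤s (s≤s (s≤s (s≤s (ℕ.≤-reflexive (ℕ.+-suc (double K) (suc K))))))))
  (ℕ.≤-trans (s≤s (s≤s (s≤s (room-bound K)))) (ℕ.n≤1+n _))

unisolated-graph : ∀ {m ℓ k W} (ω : Fin ℓ → Fin m → ℕ) → (∀ l e → ω l e ≤ W) → 1 ≤ W →
  k * 4 ≤ m → suc (k * W) ^ suc ℓ < 2 ^ k → Unisolated ω
unisolated-graph {m} {ℓ} {k} ω ω≤W 1≤W 4k≤m few
  with K , 1≤K , K<k , pair ←
         balanced-families {k = k} ω ω≤W 1≤W (ℕ.≤-trans (ℕ.*-monoʳ-≤ k (s≤s (s≤s z≤n))) 4k≤m) few
  = let fits  = ℕ.≤-trans (room-bound K) (ℕ.≤-trans (ℕ.*-monoˡ-≤ 4 K<k) 4k≤m)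
        -- All edges other than chords go to the cycle; the surplus lengthens the return path.
        n , eq = gap (ℕ.≤-trans (ℕ.m≤n+m (suc K) (3 + double K)) fits)
    in balanced⇒unisolated 1≤K
         (ℕ.+-cancelʳ-≤ (suc K) _ _ (ℕ.≤-trans fits (ℕ.≤-reflexive (sym eq)))) eq ω pair

-- Choice of the parameters

∣p∣≥1⇒nonempty : ∀ {n} {p : Subset n} → 1 ≤ ∣ p ∣ → Nonempty p
∣p∣≥1⇒nonempty {n} {p} 1≤ with nonempty? p
... | yes found = found
... | no  empty = contradiction (trans (sym (∣⊥∣≡0 n)) (cong ∣_∣ (sym (Empty-unique empty)))) (ℕ.<⇒≢ 1≤)

-- Half of a positive number of functions is more than none, so the set of good indices is
-- inhabited.
scheme-isolates : ∀ {w} (s : IsolationScheme w) {n m} (G : Graph n m) → TreewidthAtMost G w →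
                  (∃[ S ] IsHC G S) → ∃[ i ] Isolates (weights s m i) (IsHC G)
scheme-isolates s {m = m} G tw hc with I , half , isolates ← good s G tw hc
  with i , i∈I ← ∣p∣≥1⇒nonempty {p = I} (ℕ.*-cancelˡ-< 2 0 _ (ℕ.≤-trans (len-pos s m) half))
  = i , isolates i i∈I

n<2^n : ∀ n → n < 2 ^ n
n<2^n zero    = s≤s z≤n
n<2^n (suc n) = ℕ.≤-trans (ℕ.+-mono-≤ (ℕ.m^n>0 2 n) (n<2^n n))
  (ℕ.≤-reflexive (cong (2 ^ n +_) (sym (ℕ.+-identityʳ _))))

square≤2^ : ∀ n → (4 + n) * (4 + n) ≤ 2 ^ (4 + n)
square≤2^ zero    = ℕ.≤-refl
square≤2^ (suc n) = begin
  -- The added polynomial is the difference between `2 * (4 + n)²` and `(5 + n)²`.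
  (5 + n) * (5 + n)                          ≤⟨ ℕ.m≤m+n _ (7 + 6 * n + n * n) ⟩
  (5 + n) * (5 + n) + (7 + 6 * n + n * n)    ≡⟨ expand n ⟩
  2 * ((4 + n) * (4 + n))                    ≤⟨ ℕ.*-monoʳ-≤ 2 (square≤2^ n) ⟩
  2 ^ (5 + n)                                ∎
  where
  open ℕ.≤-Reasoning
  expand : ∀ n → (5 + n) * (5 + n) + (7 + 6 * n + n * n) ≡ 2 * ((4 + n) * (4 + n))
  expand = solve-∀

square-≤-cancel : ∀ {a b} → a ^ 2 ≤ b * b → a ≤ b
square-≤-cancel {a} {b} a²≤b² = ℕ.≮⇒≥ λ b<a → ℕ.<⇒≱
  (ℕ.<-≤-trans (ℕ.*-mono-< b<a b<a) (ℕ.≤-reflexive (cong (a *_) (sym (ℕ.*-identityʳ a))))) a²≤b²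

-- The bound k = 1 + (p + p)(c + 1)(ℓ + 1) makes 2 ^ k exceed m ^ ((c + 1)(ℓ + 1)) for m = 2 ^ (p + p).
selections-exceed-totals : ∀ p c ℓ → let m = 2 ^ (p + p); k = suc ((p + p) * (suc c * suc ℓ)) in
                           k * 4 ≤ m → suc (k * m ^ c) ^ suc ℓ < 2 ^ k
selections-exceed-totals p c ℓ 4k≤m = begin-strict
  suc (k * m ^ c) ^ suc ℓ             ≤⟨ ℕ.^-monoˡ-≤ (suc ℓ) (ℕ.+-monoˡ-≤ (k * m ^ c) (ℕ.m^n>0 m c)) ⟩
  -- Since `suc k ≤ k * 4 ≤ m`, the factor `suc k` costs one more power of `m`.
  (suc k * m ^ c) ^ suc ℓ             ≤⟨ ℕ.^-monoˡ-≤ (suc ℓ) (ℕ.*-monoˡ-≤ (m ^ c) (ℕ.≤-trans (ℕ.m<m*n k 4 (s≤s (s≤s z≤n))) 4k≤m)) ⟩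
  (m ^ suc c) ^ suc ℓ                 ≡⟨ ℕ.^-*-assoc m (suc c) (suc ℓ) ⟩
  m ^ (suc c * suc ℓ)                 ≡⟨ ℕ.^-*-assoc 2 (p + p) (suc c * suc ℓ) ⟩
  2 ^ ((p + p) * (suc c * suc ℓ))     <⟨ ℕ.^-monoʳ-< 2 (s≤s (s≤s z≤n)) (ℕ.n<1+n ((p + p) * (suc c * suc ℓ))) ⟩
  2 ^ k                               ∎
  where
  open ℕ.≤-Reasoning
  m = 2 ^ (p + p)
  k = suc ((p + p) * (suc c * suc ℓ))
  instance _ = ℕ.m^n≢0 2 (p + p)

-- With `q = 2 ^ p`, the bound `suc ℓ ≤ q + q` makes the left side at most `4 + 16 (c + 1) p q`,
-- hence at most `20 (c + 1) p q`; this is the origin of 20. Then `20 (c + 1) ≤ p` and `p² ≤ q`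
-- bound it by `q²`; the latter inequality asks for `4 ≤ p`.
selections-fit : ∀ p c ℓ → 4 ≤ p → 20 * suc c ≤ p → ℓ ≤ 2 ^ p →
                 suc ((p + p) * (suc c * suc ℓ)) * 4 ≤ 2 ^ (p + p)
selections-fit p@(suc (suc (suc (suc p')))) c ℓ (s≤s (s≤s (s≤s (s≤s z≤n)))) 20c≤p ℓ≤q = begin
  suc ((p + p) * (suc c * suc ℓ)) * 4      ≤⟨ ℕ.*-monoˡ-≤ 4 (s≤s (ℕ.*-monoʳ-≤ (p + p) (ℕ.*-monoʳ-≤ (suc c) (ℕ.+-mono-≤ 1≤q ℓ≤q)))) ⟩
  suc ((p + p) * (suc c * (q + q))) * 4    ≡⟨ double-twice p (suc c) q ⟩
  4 + 16 * (suc c * (p * q))               ≤⟨ ℕ.+-monoˡ-≤ _ (ℕ.*-monoʳ-≤ 4 (ℕ.*-mono-≤ (s≤s (z≤n {c})) (ℕ.*-mono-≤ (s≤s (z≤n {3 + p'})) 1≤q))) ⟩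
  4 * (suc c * (p * q)) + 16 * (suc c * (p * q)) ≡⟨ collect p (suc c) q ⟩
  20 * suc c * (p * q)                     ≤⟨ ℕ.*-monoˡ-≤ (p * q) 20c≤p ⟩
  p * (p * q)                              ≡⟨ ℕ.*-assoc p p q ⟨
  p * p * q                                ≤⟨ ℕ.*-monoˡ-≤ q (square≤2^ p') ⟩
  q * q                                    ≡⟨ ℕ.^-distribˡ-+-* 2 p p ⟨
  2 ^ (p + p)                              ∎
  where
  open ℕ.≤-Reasoning
  q = 2 ^ p
  1≤q : 1 ≤ q
  1≤q = ℕ.m^n>0 2 p
  double-twice : ∀ p c q → suc ((p + p) * (c * (q + q))) * 4 ≡ 4 + 16 * (c * (p * q))
  double-twice = solve-∀
  collect : ∀ p c q → 4 * (c * (p * q)) + 16 * (c * (p * q)) ≡ 20 * c * (p * q)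
  collect = solve-∀

theorem1p6 : ¬ Σ (IsolationScheme 4) (λ s → SubLogBits s × PolyWeights s)
theorem1p6 (s , sublog , c , N₂ , poly) with sublog 2
... | N₁ , few-functions = refute (unisolated-graph {k = suc ((p + p) * (suc c * suc (len s m)))} (weights s m) (poly m N₂≤m) (ℕ.m^n>0 m c) fits
                                     (selections-exceed-totals p c (len s m) fits))
  where
  -- The summands 4 and `20 * suc c` are the demands of `selections-fit`, and `N₁ + N₂` makes `m`
  -- large enough for both asymptotic bounds. The even exponent `p + p` gives `m` the integral
  -- square root `2 ^ p`, so that `ℓ² ≤ m` becomes `ℓ ≤ 2 ^ p`.
  p = 4 + (20 * suc c + (N₁ + N₂))
  m = 2 ^ (p + p)
  instance _ = ℕ.m^n≢0 2 (p + p)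
  p≤m : p ≤ m
  p≤m = ℕ.≤-trans (ℕ.m≤m+n p p) (ℕ.<⇒≤ (n<2^n (p + p)))
  N₁+N₂≤p : N₁ + N₂ ≤ p
  N₁+N₂≤p = ℕ.≤-trans (ℕ.m≤n+m (N₁ + N₂) (20 * suc c)) (ℕ.m≤n+m _ 4)
  N₁≤m : N₁ ≤ m
  N₁≤m = ℕ.≤-trans (ℕ.m≤m+n N₁ N₂) (ℕ.≤-trans N₁+N₂≤p p≤m)
  N₂≤m : N₂ ≤ m
  N₂≤m = ℕ.≤-trans (ℕ.m≤n+m N₂ N₁) (ℕ.≤-trans N₁+N₂≤p p≤m)
  fits : suc ((p + p) * (suc c * suc (len s m))) * 4 ≤ m
  fits = selections-fit p c (len s m) (ℕ.m≤m+n 4 _) (ℕ.≤-trans (ℕ.m≤m+n (20 * suc c) _) (ℕ.m≤n+m _ 4))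
    (square-≤-cancel (ℕ.≤-trans (few-functions m N₁≤m) (ℕ.≤-reflexive (ℕ.^-distribˡ-+-* 2 p p))))
  refute : ¬ Unisolated (weights s m)
  refute (n , G , tw , hc , unisolated) = let i , isolated = scheme-isolates s G tw hc in unisolated i isolated
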